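{- Let $M$ be a matroid of rank $r\ge 1$ on $n$ elements with no loops. Then $$T(M;x,y)=T(U_{r,n};x,y)+(xy-x-y)\sum_{k=1}^{r-1}\ \sum_{m=k}^{n}\ \sum_{t=0}^{r-k-1}f^{t}_{k,m}\,(x-1)^{r-k-t-1}\,\tau(k+1+t,\,m-k-t-1;\,y).$$
   Context: The Tutte polynomial of a rank-$r$ matroid on $S$ is $T(M;x,y)=\sum_{A\subseteq S}(x-1)^{r-\mathrm{rk}(A)}(y-1)^{|A|-\mathrm{rk}(A)}$. $U_{r,n}$ is the uniform matroid of rank $r$ on $n$ elements. The Möbius invariant of a matroid $N$ is $\mu(N)=T(N;1,0)$ (for loopless $N$ this is the absolute value of the Möbius function of the lattice of flats of $N$ evaluated from bottom to top). $\mathrm{Trun}^{s}$ denotes $s$-fold truncation; each truncation lowers the rank by one, keeping the flats of all ranks except those of corank $1$. The flat numbers of $M$ are, for $k\le m$ and $0\le t\le r-k-1$, $$f^{t}_{k,m}=(-1)^t\sum_{X}\mu(\mathrm{Trun}^{r-k-t-1}(M/X)),$$ where the sum is over all flats $X$ of $M$ with $\mathrm{rk}(X)=k$ and $|X|=m$. Here $\mathrm{Trun}^{r-k-t-1}(M/X)$ has rank $t+1$; in particular, $f^0_{k,m}$ is the number of flats of rank $k$ and size $m$. For $d\ge1$, $\alpha\ge0$: $\tau(d,\alpha;y)=\sum_{i=0}^{\alpha}\binom{\alpha+d-1-i}{\alpha-i}y^i$; and $\tau(d,\alpha;y)=0$ if $d\le 0$ or $\alpha<0$. -}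

module Defs where

open import Algebra.Bundles using (CommutativeRing)
import Algebra.Properties.Semiring.Exp as Exp
import Algebra.Properties.Semiring.Mult as Mult
open import Data.Bool.Base using (true; false)
open import Data.Fin.Base using (Fin)
open import Data.Fin.Properties using (all?; any?)
open import Data.Fin.Subset
  using (Subset; inside; outside; _∈_; _∉_; _⊆_; _∪_; _∩_; _─_; ⁅_⁆; ⊤; ∣_∣)
open import Data.Fin.Subset.Properties
open import Data.Integer.Base as ℤ using (ℤ; +_; -[1+_]; +[1+_]; 0ℤ; 1ℤ; -1ℤ)
import Data.Integer.Properties as ℤ
open import Data.List.Base using (List; []; _∷_; _++_; map; filter; foldr; applyUpTo)
open import Data.Nat.Base
  using (ℕ; zero; suc; _+_; _∸_; _≤_; _<_; _⊓_; s≤s)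
open import Data.Nat.Combinatorics using (_C_)
open import Data.Nat.GeneralisedArithmetic using (iterate)
open import Data.Nat.Properties
open import Data.Product.Base using (_×_; _,_)
open import Data.Sum.Base using (inj₁; inj₂; [_,_]′)
open import Data.Vec.Base using ([]; _∷_)
open import Function.Base using (_∘_)
open import Function.Bundles using (_⇔_; mk⇔)
open import Level using (Level)
open import Relation.Binary.PropositionalEquality
  using (_≡_; _≢_; refl; sym; trans; cong; subst; subst₂)
open import Relation.Nullary.Decidable
  using (Dec; yes; no; ¬?; _×-dec_; _→-dec_; decidable-stable)

private variable
  a c ℓ : Level
  N : ℕ

-- The ground set is a subset of Fin N, so that a minor of a matroid lives
-- in the same ambient set.  A rank function on the subsets of the ground
-- set is extended to all of Subset N by rk A = rk (A ∩ ground); this is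
-- what rk-ground says, and it makes the values outside the ground set
-- uniquely determined.
record Matroid (N : ℕ) : Set where
  field
    ground     : Subset N
    rk         : Subset N → ℕ
    rk-ground  : ∀ A → rk A ≡ rk (A ∩ ground)
    rk-card    : ∀ A → rk A ≤ ∣ A ∣
    rk-mono    : ∀ {A B} → A ⊆ B → rk A ≤ rk B
    rk-submod  : ∀ A B → rk (A ∪ B) + rk (A ∩ B) ≤ rk A + rk B

  rank : ℕ
  rank = rk ground

  rk≤rank : ∀ A → rk A ≤ rank
  rk≤rank A = subst (_≤ rank) (sym (rk-ground A)) (rk-mono (p∩q⊆q A ground))

  IsFlat : Subset N → Set
  IsFlat X = X ⊆ ground × (∀ e → e ∈ ground → e ∉ X → rk X < rk (X ∪ ⁅ e ⁆))

  isFlat? : ∀ X → Dec (IsFlat X)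
  isFlat? X = (X ⊆? ground) ×-dec
    all? (λ e → (e ∈? ground) →-dec (¬? (e ∈? X) →-dec (rk X <? rk (X ∪ ⁅ e ⁆))))

  Loopless : Set
  Loopless = ∀ e → e ∈ ground → rk ⁅ e ⁆ ≢ 0

open Matroid

private
  card-modular : (A B : Subset N) → ∣ A ∪ B ∣ + ∣ A ∩ B ∣ ≡ ∣ A ∣ + ∣ B ∣
  card-modular []            []            = refl
  card-modular (false ∷ A) (false ∷ B) = card-modular A B
  card-modular (false ∷ A) (true  ∷ B) =
    trans (cong suc (card-modular A B)) (sym (+-suc ∣ A ∣ ∣ B ∣))
  card-modular (true  ∷ A) (false ∷ B) = cong suc (card-modular A B)
  card-modular (true  ∷ A) (true  ∷ B) = cong suc
    (trans (+-suc ∣ A ∪ B ∣ ∣ A ∩ B ∣)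
      (trans (cong suc (card-modular A B)) (sym (+-suc ∣ A ∣ ∣ B ∣))))

  ⊓-submod : ∀ c {u i p q} → u + i ≤ p + q → i ≤ p → i ≤ q →
             (c ⊓ u) + (c ⊓ i) ≤ (c ⊓ p) + (c ⊓ q)
  ⊓-submod c {u} {i} {p} {q} h i≤p i≤q with ≤-total c p | ≤-total c q
  ... | inj₁ c≤p | _ = subst (λ z → (c ⊓ u) + (c ⊓ i) ≤ z + (c ⊓ q))
    (sym (m≤n⇒m⊓n≡m c≤p)) (+-mono-≤ (m⊓n≤m c u) (⊓-monoʳ-≤ c i≤q))
  ... | inj₂ _ | inj₁ c≤q = subst (λ z → (c ⊓ u) + (c ⊓ i) ≤ (c ⊓ p) + z)
    (sym (m≤n⇒m⊓n≡m c≤q))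
    (subst ((c ⊓ u) + (c ⊓ i) ≤_) (+-comm c (c ⊓ p))
      (+-mono-≤ (m⊓n≤m c u) (⊓-monoʳ-≤ c i≤p)))
  ... | inj₂ p≤c | inj₂ q≤c = subst₂ (λ y z → (c ⊓ u) + (c ⊓ i) ≤ y + z)
    (sym (m≥n⇒m⊓n≡n p≤c)) (sym (m≥n⇒m⊓n≡n q≤c))
    (≤-trans (+-mono-≤ (m⊓n≤n c u) (m⊓n≤n c i)) h)

  ∸-submod : ∀ d {u i p q} → u + i ≤ p + q → d ≤ u → d ≤ i → d ≤ p → d ≤ q →
             (u ∸ d) + (i ∸ d) ≤ (p ∸ d) + (q ∸ d)
  ∸-submod d {u} {i} {p} {q} h du di dp dq =
    subst₂ _≤_ (split du di) (split dp dq) (∸-monoˡ-≤ d (∸-monoˡ-≤ d h))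
    where
    split : ∀ {v w} → d ≤ v → d ≤ w → (v + w) ∸ d ∸ d ≡ (v ∸ d) + (w ∸ d)
    split {v} {w} dv dw = trans (cong (_∸ d) (+-∸-comm w dv)) (+-∸-assoc (v ∸ d) dw)

  ∪-∩-ground : (A X E : Subset N) → (A ∪ X) ∩ E ≡ ((A ∩ (E ─ X)) ∪ X) ∩ E
  ∪-∩-ground []          []          []          = refl
  ∪-∩-ground (false ∷ A) (x     ∷ X) (e     ∷ E) = cong (_ ∷_) (∪-∩-ground A X E)
  ∪-∩-ground (true  ∷ A) (true  ∷ X) (true  ∷ E) = cong (_ ∷_) (∪-∩-ground A X E)
  ∪-∩-ground (true  ∷ A) (true  ∷ X) (false ∷ E) = cong (_ ∷_) (∪-∩-ground A X E)
  ∪-∩-ground (true  ∷ A) (false ∷ X) (true  ∷ E) = cong (_ ∷_) (∪-∩-ground A X E)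
  ∪-∩-ground (true  ∷ A) (false ∷ X) (false ∷ E) = cong (_ ∷_) (∪-∩-ground A X E)

  ∪-monoˡ : {A B : Subset N} (X : Subset N) → A ⊆ B → A ∪ X ⊆ B ∪ X
  ∪-monoˡ {A = A} X A⊆B =
    x∈p∪q⁺ ∘ [ inj₁ ∘ A⊆B , inj₂ ]′ ∘ x∈p∪q⁻ A X

  ∪-∪-∪ : (A B X : Subset N) → (A ∪ X) ∪ (B ∪ X) ≡ (A ∪ B) ∪ X
  ∪-∪-∪ []          []      []      = refl
  ∪-∪-∪ (true  ∷ A) (_ ∷ B) (_ ∷ X) = cong (_ ∷_) (∪-∪-∪ A B X)
  ∪-∪-∪ (false ∷ A) (true ∷ B) (true ∷ X) = cong (_ ∷_) (∪-∪-∪ A B X)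
  ∪-∪-∪ (false ∷ A) (true ∷ B) (false ∷ X) = cong (_ ∷_) (∪-∪-∪ A B X)
  ∪-∪-∪ (false ∷ A) (false ∷ B) (true ∷ X) = cong (_ ∷_) (∪-∪-∪ A B X)
  ∪-∪-∪ (false ∷ A) (false ∷ B) (false ∷ X) = cong (_ ∷_) (∪-∪-∪ A B X)

-- U_{r,n}, with the usual rank function min(r , ∣A∣); for r > n (excluded
-- when r is the rank of a matroid on n elements) this is U_{n,n}.
uniform : (r n : ℕ) → Matroid n
uniform r n = record
  { ground    = ⊤
  ; rk        = λ A → r ⊓ ∣ A ∣
  ; rk-ground = λ A → cong (λ B → r ⊓ ∣ B ∣) (sym (∩-identityʳ A))
  ; rk-card   = λ A → m⊓n≤n r ∣ A ∣
  ; rk-mono   = λ A⊆B → ⊓-monoʳ-≤ r (p⊆q⇒∣p∣≤∣q∣ A⊆B)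
  ; rk-submod = λ A B → ⊓-submod r (≤-reflexive (card-modular A B))
                          (∣p∩q∣≤∣p∣ A B) (∣p∩q∣≤∣q∣ A B)
  }

-- Contraction.  X need not be contained in the ground set; by rk-ground the
-- result is then the contraction by X ∩ ground.
infixl 7 _/_
_/_ : Matroid N → Subset N → Matroid N
M / X = record
  { ground    = ground M ─ X
  ; rk        = λ A → rk M (A ∪ X) ∸ rk M X
  ; rk-ground = λ A → cong (_∸ rk M X)
      (trans (rk-ground M (A ∪ X))
        (trans (cong (rk M) (∪-∩-ground A X (ground M)))
          (sym (rk-ground M ((A ∩ (ground M ─ X)) ∪ X)))))
  ; rk-card   = λ A → ≤-trans
      (m≤n+o⇒m∸n≤o (rk M (A ∪ X)) (rk M X)
        (subst (rk M (A ∪ X) ≤_) (+-comm (rk M A) (rk M X))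
          (≤-trans (m≤m+n _ _) (rk-submod M A X))))
      (rk-card M A)
  ; rk-mono   = λ A⊆B → ∸-monoˡ-≤ (rk M X) (rk-mono M (∪-monoˡ X A⊆B))
  ; rk-submod = λ A B → ∸-submod (rk M X)
      (subst₂ (λ U I → rk M U + rk M I ≤ rk M (A ∪ X) + rk M (B ∪ X))
        (∪-∪-∪ A B X) (sym (∪-distribʳ-∩ X A B))
        (rk-submod M (A ∪ X) (B ∪ X)))
      (above (A ∪ B)) (above (A ∩ B)) (above A) (above B)
  }
  where
  above : ∀ A → rk M X ≤ rk M (A ∪ X)
  above A = rk-mono M (q⊆p∪q A X)

truncate : Matroid N → Matroid N
truncate M = record
  { ground    = ground M
  ; rk        = λ A → r-1 ⊓ rk M A
  ; rk-ground = λ A → cong (r-1 ⊓_) (rk-ground M A)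
  ; rk-card   = λ A → ≤-trans (m⊓n≤n r-1 (rk M A)) (rk-card M A)
  ; rk-mono   = λ A⊆B → ⊓-monoʳ-≤ r-1 (rk-mono M A⊆B)
  ; rk-submod = λ A B → ⊓-submod r-1 (rk-submod M A B)
      (rk-mono M (p∩q⊆p A B)) (rk-mono M (p∩q⊆q A B))
  }
  where
  r-1 = rank M ∸ 1

Trun^ : ℕ → Matroid N → Matroid N
Trun^ s M = iterate truncate M s

rank-truncate : (M : Matroid N) → rank (truncate M) ≡ rank M ∸ 1
rank-truncate M = m≤n⇒m⊓n≡m (m∸n≤m (rank M) 1)

-- The description of truncation by flats, for rank at least 1, agrees with
-- the definition by rank functions.
flats-truncate : (M : Matroid N) → 1 ≤ rank M → ∀ X →
                 IsFlat (truncate M) X ⇔ (IsFlat M X × suc (rk M X) ≢ rank M)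
flats-truncate M 1≤r X = mk⇔ to from
  where
  r = rank M

  to : IsFlat (truncate M) X → IsFlat M X × suc (rk M X) ≢ r
  to (X⊆E , closed) = (X⊆E , closed′) , corank
    where
    closed′ : ∀ e → e ∈ ground M → e ∉ X → rk M X < rk M (X ∪ ⁅ e ⁆)
    closed′ e e∈E e∉X = ≰⇒> λ le →
      <⇒≱ (closed e e∈E e∉X) (⊓-monoʳ-≤ (r ∸ 1) le)

    corank : suc (rk M X) ≢ r
    corank eq with any? (λ e → (e ∈? ground M) ×-dec ¬? (e ∈? X))
    ... | yes (e , e∈E , e∉X) = <⇒≱ (closed e e∈E e∉X)
      (≤-trans (m⊓n≤m (r ∸ 1) _)
        (≤-reflexive (sym (m≤n⇒m⊓n≡m (≤-reflexive (cong (_∸ 1) (sym eq)))))))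
    ... | no none = 1+n≰n (subst (_≤ rk M X) (sym eq)
      (rk-mono M λ {e} e∈E → decidable-stable (e ∈? X) λ e∉X → none (e , e∈E , e∉X)))

  from : IsFlat M X × suc (rk M X) ≢ r → IsFlat (truncate M) X
  from ((X⊆E , closed) , corank) = X⊆E , closed′
    where
    closed′ : ∀ e → e ∈ ground M → e ∉ X →
              (r ∸ 1) ⊓ rk M X < (r ∸ 1) ⊓ rk M (X ∪ ⁅ e ⁆)
    closed′ e e∈E e∉X = ≤-trans (s≤s (m⊓n≤n (r ∸ 1) (rk M X)))
      (⊓-glb (∸-monoˡ-≤ 1 below) (closed e e∈E e∉X))
      where
      below : suc (rk M X) < r
      below = ≤∧≢⇒< (≤-trans (closed e e∈E e∉X) (rk≤rank M _)) corank

subsets : Subset N → List (Subset N)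
subsets []            = [] ∷ []
subsets (outside ∷ E) = map (outside ∷_) (subsets E)
subsets (inside  ∷ E) = map (outside ∷_) (subsets E) ++ map (inside ∷_) (subsets E)

flats : Matroid N → List (Subset N)
flats M = filter (isFlat? M) (subsets (ground M))

-- Both endpoints are included; empty if hi < lo.
[_⋯_] : ℕ → ℕ → List ℕ
[ lo ⋯ hi ] = applyUpTo (λ i → lo + i) (suc hi ∸ lo)

-- A polynomial identity over ℤ in x and y is stated as an identity between
-- elements of an arbitrary commutative ring R, for arbitrary x, y in R;
-- R = ℤ[x,y] with its two variables gives back the formal identity.

module Polynomials (R : CommutativeRing c ℓ) where
  open CommutativeRing R using (Carrier; 0#; 1#; _-_; -_; semiring)
    renaming (_+_ to _⊕_; _*_ to _⊗_)
  open Exp semiring public using (_^_)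
  open Mult semiring using () renaming (_×_ to _·_)

  infix 5 ∑
  ∑ : {I : Set a} → List I → (I → Carrier) → Carrier
  ∑ is term = foldr (λ i s → term i ⊕ s) 0# is

  syntax ∑ is (λ i → term) = ∑[ i ← is ] term

  -- The unique ring homomorphism ℤ → R.
  ι : ℤ → Carrier
  ι (+ n)    = n · 1#
  ι -[1+ n ] = - (suc n · 1#)

  T : Matroid N → Carrier → Carrier → Carrier
  T M x y = ∑[ A ← subsets (ground M) ]
    (x - 1#) ^ (rank M ∸ rk M A) ⊗ (y - 1#) ^ (∣ A ∣ ∸ rk M A)

  -- Integer arguments, since α = m - k - t - 1 is negative for some terms
  -- of the expansion.
  τ : ℤ → ℤ → Carrier → Carrier
  τ d@(+[1+ _ ]) (+ α) y =
    ∑[ i ← [ 0 ⋯ α ] ] ((α + ℤ.∣ d ∣ ∸ 1 ∸ i) C (α ∸ i)) · (y ^ i)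
  τ _ _ _ = 0#

private module ℤPoly = Polynomials ℤ.+-*-commutativeRing

μ : Matroid N → ℤ
μ M = ℤPoly.T M 1ℤ 0ℤ

-- flatNumber M t k m is f^t_{k,m}.
flatNumber : Matroid N → (t k m : ℕ) → ℤ
flatNumber M t k m = -1ℤ ℤ.^ t ℤ.* ℤPoly.∑
  (filter (λ X → (rk M X ≟ k) ×-dec (∣ X ∣ ≟ m)) (flats M))
  (λ X → μ (Trun^ (rank M ∸ k ∸ t ∸ 1) (M / X)))

{-# OPTIONS --safe #-}

-- Put a = x - 1, b = y - 1 and u = xy - x - y, so that ab = 1 + u.  For a set A
-- of rank ρ and size s, the telescoping sum of (ab)^j turns the difference of
-- its terms in T(M) and T(U_{r,n}) into
--   u * ∑ (ρ ≤ i < min(r , s)) a^(r-1-i) b^(s-1-i).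
-- Fix the level i.  Möbius inversion in the Boolean lattice rewrites
-- ∑ (A : rk A ≤ i) w(A) as ∑ X, c_i(X) ∑ (A ⊆ X) w(A), with
--   c_i(X) = ∑ (B ⊆ E ─ X : rk(B ∪ X) ≤ i) (-1)^∣B∣.
-- If X is not a flat, toggling an element of its closure cancels c_i(X); if X is
-- a flat of rank k, then c_i(X) = (-1)^t μ(Trun^{r-k-t-1}(M/X)) for t = i - k.
-- Finally, for w(A) = b^(∣A∣-1-i) on the sets with more than i elements, the
-- inner sum is τ(i+1, ∣X∣-i-1; y), by Pascal's rule.

module Submission where

open import Defs
open import Algebra.Bundles using (CommutativeRing)
import Algebra.Properties.CommutativeSemigroup as CommutativeSemigroup
import Algebra.Properties.Ring as RingProperties
import Algebra.Properties.Semiring.Exp as Exp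
import Algebra.Properties.Semiring.Mult as Mult
open import Data.Bool.Base using (Bool; true; false; _∧_)
open import Data.Fin.Base using (Fin; zero; suc)
open import Data.Fin.Properties using (any?)
open import Data.Fin.Subset
  using (Subset; inside; outside; _∈_; _⊆_; _∪_; _∩_; _─_; ⁅_⁆; ⊤; ∣_∣)
open import Data.Fin.Subset.Properties
open import Data.Integer.Base as ℤ using (ℤ; +_; -[1+_])
import Data.Integer.Properties as ℤ
open import Data.List.Base using (List; []; _∷_; _++_; map; filter; applyUpTo; upTo)
open import Data.List.Relation.Unary.All as All using (All; []; _∷_)
open import Data.List.Relation.Unary.All.Properties using (++⁺; map⁺; applyUpTo⁺₁)
open import Data.Nat.Base as ℕ
  using (ℕ; zero; suc; _≤_; _<_; _∸_; _⊓_; _<ᵇ_; z≤n; s≤s)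
open import Data.Nat.Combinatorics using (_C_; nCk+nC[k+1]≡[n+1]C[k+1]; nCn≡1)
import Data.Nat.Properties as ℕ
open import Data.Product.Base using (∃; _×_; _,_)
open import Data.Sum.Base using (inj₁; inj₂)
open import Data.Vec.Base using ([]; _∷_; here; there)
open import Function.Base using (_∘_; id)
open import Level using (Level)
open import Relation.Binary.PropositionalEquality as ≡ using (_≡_)
open import Relation.Nullary using (Dec; does; yes; no; ¬_; contradiction; _×-dec_)
open import Relation.Nullary.Decidable using (decidable-stable)
open import Relation.Unary using (Decidable)

open Matroid

private variable
  ℓ₁ ℓ₂ : Level
  I J : Set ℓ₁
  N : ℕ

-- Index arithmetic with truncated subtraction

⋯-upper : ∀ lo {hi i} → i < suc hi ∸ lo → lo ℕ.+ i ≤ hi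
⋯-upper zero                i< = ℕ.≤-pred i<
⋯-upper (suc lo) {suc hi}   i< = s≤s (⋯-upper lo i<)
⋯-upper (suc lo) {zero} {i} i< with () ← ≡.subst (i <_) (ℕ.0∸n≡0 lo) i<

-- For `r = 0` the bound `r ∸ 1` is again 0, a case that `1 ≤ k` excludes.
≤∸1⇒< : ∀ {k r} → 1 ≤ k → k ≤ r ∸ 1 → k < r
≤∸1⇒< {r = suc r} _       k≤r = s≤s k≤r
≤∸1⇒< {r = zero}  (s≤s _) ()

-- Turns the bound `t` on a rank in `M / X`, which is a truncated difference, into the bound `k + t`
-- on a rank in `M`.
<ᵇ-∸ : ∀ k {n} t → k ≤ n → (n ∸ k <ᵇ suc t) ≡ (n <ᵇ suc (k ℕ.+ t))
<ᵇ-∸ zero    t _         = ≡.refl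
<ᵇ-∸ (suc k) t (s≤s k≤n) = <ᵇ-∸ k t k≤n

∸-∸-1 : ∀ r k t → r ∸ k ∸ t ∸ 1 ≡ r ∸ suc (k ℕ.+ t)
∸-∸-1 r k t = ≡.trans (≡.cong (_∸ 1) (ℕ.∸-+-assoc r k t))
  (≡.trans (ℕ.∸-+-assoc r (k ℕ.+ t) 1) (≡.cong (r ∸_) (ℕ.+-comm (k ℕ.+ t) 1)))

τ-argument : ∀ m k t → + m ℤ.- + k ℤ.- + t ℤ.- + 1 ≡ m ℤ.⊖ suc (k ℕ.+ t)
τ-argument m k t = begin
  + m ℤ.- + k ℤ.- + t ℤ.- + 1       ≡⟨ ≡.cong (ℤ._- + 1) (minus-minus (+ m) (+ k) (+ t)) ⟩
  + m ℤ.- + (k ℕ.+ t) ℤ.- + 1       ≡⟨ minus-minus (+ m) (+ (k ℕ.+ t)) (+ 1) ⟩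
  + m ℤ.- + (k ℕ.+ t ℕ.+ 1)         ≡⟨ ≡.cong (λ j → + m ℤ.- + j) (ℕ.+-comm (k ℕ.+ t) 1) ⟩
  + m ℤ.- + suc (k ℕ.+ t)           ≡⟨ ℤ.m-n≡m⊖n m (suc (k ℕ.+ t)) ⟩
  m ℤ.⊖ suc (k ℕ.+ t)               ∎
  where
  open ≡.≡-Reasoning
  minus-minus : ∀ i j l → i ℤ.- j ℤ.- l ≡ i ℤ.- (j ℤ.+ l)
  minus-minus i j l = ≡.trans (ℤ.+-assoc i (ℤ.- j) (ℤ.- l))
    (≡.cong (λ k → i ℤ.+ k) (≡.sym (ℤ.neg-distrib-+ j l)))

subsets-⊆ : (E : Subset N) → All (_⊆ E) (subsets E)
subsets-⊆ []            = id ∷ []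
subsets-⊆ (outside ∷ E) = map⁺ (All.map s⊆s (subsets-⊆ E))
subsets-⊆ (inside  ∷ E) =
  ++⁺ (map⁺ (All.map out⊆ (subsets-⊆ E))) (map⁺ (All.map in⊆in (subsets-⊆ E)))

-- Flats, contraction and truncation

-- By submodularity for `B ∪ X` and `X ∪ ⁅ e ⁆`, whose intersection contains `X`, adding `e` to
-- `B ∪ X` raises the rank by at most what adding it to `X` does, which is nothing.
rk-∪⁅⁆ : (M : Matroid N) {X : Subset N} {e : Fin N} → rk M (X ∪ ⁅ e ⁆) ≤ rk M X →
         ∀ B → rk M ((B ∪ ⁅ e ⁆) ∪ X) ≡ rk M (B ∪ X)
rk-∪⁅⁆ M {X} {e} spanned B = ℕ.≤-antisym (ℕ.+-cancelʳ-≤ (rk M X) _ _ below)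
  (rk-mono M (λ x∈ → swap (p⊆p∪q ⁅ e ⁆ x∈)))
  where
  swap : (B ∪ X) ∪ ⁅ e ⁆ ⊆ (B ∪ ⁅ e ⁆) ∪ X
  swap = ⊆-reflexive (≡.trans (∪-assoc B X ⁅ e ⁆)
    (≡.trans (≡.cong (B ∪_) (∪-comm X ⁅ e ⁆)) (≡.sym (∪-assoc B ⁅ e ⁆ X))))
  cover : (B ∪ ⁅ e ⁆) ∪ X ⊆ (B ∪ X) ∪ (X ∪ ⁅ e ⁆)
  cover x∈ with x∈p∪q⁻ (B ∪ ⁅ e ⁆) X x∈
  ... | inj₂ x∈X = p⊆p∪q (X ∪ ⁅ e ⁆) (q⊆p∪q B X x∈X)
  ... | inj₁ x∈Be with x∈p∪q⁻ B ⁅ e ⁆ x∈Be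
  ...   | inj₁ x∈B = p⊆p∪q (X ∪ ⁅ e ⁆) (p⊆p∪q X x∈B)
  ...   | inj₂ x∈e = q⊆p∪q (B ∪ X) (X ∪ ⁅ e ⁆) (q⊆p∪q X ⁅ e ⁆ x∈e)
  X⊆∩ : X ⊆ (B ∪ X) ∩ (X ∪ ⁅ e ⁆)
  X⊆∩ x∈X = x∈p∩q⁺ (q⊆p∪q B X x∈X , p⊆p∪q ⁅ e ⁆ x∈X)
  below : rk M ((B ∪ ⁅ e ⁆) ∪ X) ℕ.+ rk M X ≤ rk M (B ∪ X) ℕ.+ rk M X
  below = begin
    rk M ((B ∪ ⁅ e ⁆) ∪ X) ℕ.+ rk M X
      ≤⟨ ℕ.+-mono-≤ (rk-mono M cover) (rk-mono M X⊆∩) ⟩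
    rk M ((B ∪ X) ∪ (X ∪ ⁅ e ⁆)) ℕ.+ rk M ((B ∪ X) ∩ (X ∪ ⁅ e ⁆))
      ≤⟨ rk-submod M (B ∪ X) (X ∪ ⁅ e ⁆) ⟩
    rk M (B ∪ X) ℕ.+ rk M (X ∪ ⁅ e ⁆)
      ≤⟨ ℕ.+-monoʳ-≤ (rk M (B ∪ X)) spanned ⟩
    rk M (B ∪ X) ℕ.+ rk M X
      ∎
    where open ℕ.≤-Reasoning

-- Supplies the element that is toggled in `coefficient-non-flat`.
non-flat⇒spanned : (M : Matroid N) {X : Subset N} → X ⊆ ground M → ¬ IsFlat M X →
                   ∃ λ e → e ∈ ground M ─ X × rk M (X ∪ ⁅ e ⁆) ≤ rk M X
non-flat⇒spanned M {X} X⊆E ¬flat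
  with any? (λ e → (e ∈? (ground M ─ X)) ×-dec (rk M (X ∪ ⁅ e ⁆) ℕ.≤? rk M X))
... | yes found = found
... | no  none  = contradiction
  ((λ {x} → X⊆E {x}) , λ e e∈E e∉X → ℕ.≰⇒> λ le → none (e , x∈p∧x∉q⇒x∈p─q e∈E e∉X , le)) ¬flat

-- Otherwise `X` would contain the ground set and have full rank. The element makes the signs of all
-- subsets of the ground set of `M / X` cancel.
rk<rank⇒∃─ : (M : Matroid N) {X : Subset N} → rk M X < rank M → ∃ λ e → e ∈ ground M ─ X
rk<rank⇒∃─ M {X} rk<rank with nonempty? (ground M ─ X)
... | yes found = found
... | no  none  = contradiction (rk-mono M E⊆X) (ℕ.<⇒≱ rk<rank)
  where
  E⊆X : ground M ⊆ X
  E⊆X {e} e∈E = decidable-stable (e ∈? X) λ e∉X → none (e , x∈p∧x∉q⇒x∈p─q e∈E e∉X)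

rank-/ : (M : Matroid N) (X : Subset N) → rank (M / X) ≡ rank M ∸ rk M X
rank-/ M X = ≡.cong (_∸ rk M X) (ℕ.≤-antisym (rk≤rank M _) (rk-mono M E⊆))
  where
  E⊆ : ground M ⊆ (ground M ─ X) ∪ X
  E⊆ {e} e∈E with e ∈? X
  ... | yes e∈X = q⊆p∪q (ground M ─ X) X e∈X
  ... | no  e∉X = p⊆p∪q X (x∈p∧x∉q⇒x∈p─q e∈E e∉X)

ground-Trun : ∀ s (M : Matroid N) → ground (Trun^ s M) ≡ ground M
ground-Trun zero    M = ≡.refl
ground-Trun (suc s) M = ground-Trun s (truncate M)

-- Each truncation caps the rank one lower, and in the iterated minimum only the smallest cap
-- survives.
rk-Trun : ∀ s (M : Matroid N) A → rk (Trun^ s M) A ≡ (rank M ∸ s) ⊓ rk M A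
rk-Trun zero    M A = ≡.sym (ℕ.m≥n⇒m⊓n≡n (rk≤rank M A))
rk-Trun (suc s) M A = begin
  rk (Trun^ s (truncate M)) A                        ≡⟨ rk-Trun s (truncate M) A ⟩
  (rank (truncate M) ∸ s) ⊓ ((rank M ∸ 1) ⊓ rk M A)  ≡⟨ ≡.cong (λ k → (k ∸ s) ⊓ ((rank M ∸ 1) ⊓ rk M A)) (rank-truncate M) ⟩
  (rank M ∸ 1 ∸ s) ⊓ ((rank M ∸ 1) ⊓ rk M A)         ≡⟨ ℕ.⊓-assoc (rank M ∸ 1 ∸ s) _ _ ⟨
  ((rank M ∸ 1 ∸ s) ⊓ (rank M ∸ 1)) ⊓ rk M A         ≡⟨ ≡.cong (_⊓ rk M A) (ℕ.m≤n⇒m⊓n≡m (ℕ.m∸n≤m _ s)) ⟩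
  (rank M ∸ 1 ∸ s) ⊓ rk M A                          ≡⟨ ≡.cong (_⊓ rk M A) (ℕ.∸-+-assoc (rank M) 1 s) ⟩
  (rank M ∸ suc s) ⊓ rk M A                          ∎
  where open ≡.≡-Reasoning

rank-Trun : ∀ s (M : Matroid N) → rank (Trun^ s M) ≡ rank M ∸ s
rank-Trun s M = ≡.trans (≡.cong (rk (Trun^ s M)) (ground-Trun s M))
  (≡.trans (rk-Trun s M (ground M)) (ℕ.m≤n⇒m⊓n≡m (ℕ.m∸n≤m (rank M) s)))

-- An element of `X` would be a loop by monotonicity. This is why the sum over flats may start at
-- rank 1.
loopless-rk-0 : (M : Matroid N) → Loopless M → ∀ {X} → X ⊆ ground M → rk M X ≡ 0 → ∣ X ∣ ≡ 0
loopless-rk-0 {N} M loopless {X} X⊆E rk≡0 with nonempty? X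
... | no  empty     = ≡.trans (≡.cong ∣_∣ (Empty-unique empty)) (∣⊥∣≡0 N)
... | yes (e , e∈X) = contradiction
  (ℕ.n≤0⇒n≡0 (ℕ.≤-trans (rk-mono M ⁅e⁆⊆X) (ℕ.≤-reflexive rk≡0))) (loopless e (X⊆E e∈X))
  where
  ⁅e⁆⊆X : ⁅ e ⁆ ⊆ X
  ⁅e⁆⊆X x∈ = ≡.subst (_∈ X) (≡.sym (x∈⁅y⁆⇒x≡y e x∈)) e∈X

module SubsetSums {c ℓ} (R : CommutativeRing c ℓ) where
  open CommutativeRing R
  open Polynomials R
  open RingProperties ring
  open Mult semiring renaming (_×_ to _·_)
  open Exp semiring using (^-homo-*; ^-congˡ)
  open import Relation.Binary.Reasoning.Setoid setoid
  private
    module +-CS = CommutativeSemigroup +-commutativeSemigroup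
    module *-CS = CommutativeSemigroup *-commutativeSemigroup

  -- Finite sums over lists and intervals, and indicators

  𝟙 : Bool → Carrier
  𝟙 true  = 1#
  𝟙 false = 0#

  ∑-cong-All : {xs : List I} {f g : I → Carrier} →
               All (λ i → f i ≈ g i) xs → ∑ xs f ≈ ∑ xs g
  ∑-cong-All []         = refl
  ∑-cong-All (eq ∷ eqs) = +-cong eq (∑-cong-All eqs)

  ∑-cong : (xs : List I) {f g : I → Carrier} → (∀ i → f i ≈ g i) → ∑ xs f ≈ ∑ xs g
  ∑-cong xs eq = ∑-cong-All (All.universal eq xs)

  ∑-zero : (xs : List I) → ∑ xs (λ _ → 0#) ≈ 0#
  ∑-zero []       = refl
  ∑-zero (_ ∷ xs) = trans (+-identityˡ _) (∑-zero xs)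

  ∑-++ : (xs ys : List I) (f : I → Carrier) → ∑ (xs ++ ys) f ≈ ∑ xs f + ∑ ys f
  ∑-++ []       ys f = sym (+-identityˡ _)
  ∑-++ (x ∷ xs) ys f = trans (+-congˡ (∑-++ xs ys f)) (sym (+-assoc _ _ _))

  ∑-map : (g : J → I) (xs : List J) (f : I → Carrier) → ∑ (map g xs) f ≈ ∑ xs (f ∘ g)
  ∑-map g []       f = refl
  ∑-map g (x ∷ xs) f = +-congˡ (∑-map g xs f)

  ∑-applyUpTo : (g : ℕ → I) (n : ℕ) (f : I → Carrier) →
                ∑ (applyUpTo g n) f ≈ ∑ (upTo n) (f ∘ g)
  ∑-applyUpTo g n f = go id n
    where
    -- `applyUpTo` recurses by composing its function with `suc`, so the induction has to run over
    -- all `h`.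
    go : ∀ h n → ∑ (applyUpTo (g ∘ h) n) f ≈ ∑ (applyUpTo h n) (f ∘ g)
    go h zero    = refl
    go h (suc n) = +-congˡ (go (h ∘ suc) n)

  ∑-+ : (xs : List I) (f g : I → Carrier) →
        ∑ xs (λ i → f i + g i) ≈ ∑ xs f + ∑ xs g
  ∑-+ []       f g = sym (+-identityˡ 0#)
  ∑-+ (x ∷ xs) f g = trans (+-congˡ (∑-+ xs f g)) (+-CS.interchange _ _ _ _)

  ∑-*ˡ : (z : Carrier) (xs : List I) (f : I → Carrier) →
         ∑ xs (λ i → z * f i) ≈ z * ∑ xs f
  ∑-*ˡ z []       f = sym (zeroʳ z)
  ∑-*ˡ z (x ∷ xs) f = trans (+-congˡ (∑-*ˡ z xs f)) (sym (distribˡ z _ _))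

  ∑-*ʳ : (z : Carrier) (xs : List I) (f : I → Carrier) →
         ∑ xs (λ i → f i * z) ≈ ∑ xs f * z
  ∑-*ʳ z xs f = trans (∑-cong xs (λ i → *-comm (f i) z))
                      (trans (∑-*ˡ z xs f) (*-comm z _))

  ∑-neg : (xs : List I) (f : I → Carrier) → ∑ xs (λ i → - f i) ≈ - ∑ xs f
  ∑-neg xs f = begin
    ∑ xs (λ i → - f i)      ≈⟨ ∑-cong xs (λ i → sym (-1*x≈-x (f i))) ⟩
    ∑ xs (λ i → - 1# * f i) ≈⟨ ∑-*ˡ (- 1#) xs f ⟩
    - 1# * ∑ xs f           ≈⟨ -1*x≈-x _ ⟩
    - ∑ xs f                ∎

  ∑-comm : (xs : List I) (ys : List J) (f : I → J → Carrier) →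
           ∑ xs (λ i → ∑ ys (f i)) ≈ ∑ ys (λ j → ∑ xs (λ i → f i j))
  ∑-comm []       ys f = sym (∑-zero ys)
  ∑-comm (x ∷ xs) ys f = trans (+-congˡ (∑-comm xs ys f)) (sym (∑-+ ys _ _))

  ∑-filter : {P : I → Set ℓ₂} (P? : Decidable P) (xs : List I) (f : I → Carrier) →
             ∑ (filter P? xs) f ≈ ∑ xs (λ i → 𝟙 (does (P? i)) * f i)
  ∑-filter P? []       f = refl
  ∑-filter P? (x ∷ xs) f with does (P? x)
  ... | true  = +-cong (sym (*-identityˡ _)) (∑-filter P? xs f)
  ... | false = trans (∑-filter P? xs f)
                      (sym (trans (+-congʳ (zeroˡ _)) (+-identityˡ _)))

  ∑-upTo-sucˡ : ∀ n (f : ℕ → Carrier) →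
                ∑ (upTo (suc n)) f ≈ f 0 + ∑ (upTo n) (f ∘ suc)
  ∑-upTo-sucˡ n f = +-congˡ (∑-applyUpTo suc n f)

  ∑-upTo-+ : ∀ m n (f : ℕ → Carrier) →
             ∑ (upTo (m ℕ.+ n)) f ≈ ∑ (upTo m) f + ∑ (upTo n) (λ i → f (m ℕ.+ i))
  ∑-upTo-+ zero    n f = sym (+-identityˡ _)
  ∑-upTo-+ (suc m) n f = begin
    ∑ (upTo (suc (m ℕ.+ n))) f                          ≈⟨ ∑-upTo-sucˡ (m ℕ.+ n) f ⟩
    f 0 + ∑ (upTo (m ℕ.+ n)) (f ∘ suc)                  ≈⟨ +-congˡ (∑-upTo-+ m n (f ∘ suc)) ⟩
    f 0 + (∑ (upTo m) (f ∘ suc) + rest)                 ≈⟨ +-assoc _ _ _ ⟨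
    (f 0 + ∑ (upTo m) (f ∘ suc)) + rest                 ≈⟨ +-congʳ (∑-upTo-sucˡ m f) ⟨
    ∑ (upTo (suc m)) f + rest                           ∎
    where
    rest = ∑ (upTo n) (λ i → f (suc m ℕ.+ i))

  ∑-upTo-sucʳ : ∀ n (f : ℕ → Carrier) → ∑ (upTo (suc n)) f ≈ ∑ (upTo n) f + f n
  ∑-upTo-sucʳ n f = begin
    ∑ (upTo (suc n)) f                  ≡⟨ ≡.cong (λ k → ∑ (upTo k) f) (ℕ.+-comm 1 n) ⟩
    ∑ (upTo (n ℕ.+ 1)) f                ≈⟨ ∑-upTo-+ n 1 f ⟩
    ∑ (upTo n) f + (f (n ℕ.+ 0) + 0#)   ≈⟨ +-congˡ (+-identityʳ _) ⟩
    ∑ (upTo n) f + f (n ℕ.+ 0)          ≡⟨ ≡.cong (λ k → ∑ (upTo n) f + f k) (ℕ.+-identityʳ n) ⟩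
    ∑ (upTo n) f + f n                  ∎

  ∑-⋯ : ∀ lo hi (f : ℕ → Carrier) →
        ∑ [ lo ⋯ hi ] f ≈ ∑ (upTo (suc hi ∸ lo)) (λ i → f (lo ℕ.+ i))
  ∑-⋯ lo hi f = ∑-applyUpTo (lo ℕ.+_) (suc hi ∸ lo) f

  ∑-⋯-cong : ∀ lo hi {f g : ℕ → Carrier} →
             (∀ {k} → lo ≤ k → k ≤ hi → f k ≈ g k) →
             ∑ [ lo ⋯ hi ] f ≈ ∑ [ lo ⋯ hi ] g
  ∑-⋯-cong lo hi eq = ∑-cong-All (applyUpTo⁺₁ (lo ℕ.+_) (suc hi ∸ lo) λ i< →
    eq (ℕ.m≤m+n lo _) (⋯-upper lo i<))

  ∑-upTo-cong : ∀ n {f g : ℕ → Carrier} → (∀ {i} → i < n → f i ≈ g i) →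
                ∑ (upTo n) f ≈ ∑ (upTo n) g
  ∑-upTo-cong n eq = ∑-cong-All (applyUpTo⁺₁ id n eq)

  ∑-upTo-zero : ∀ n {f : ℕ → Carrier} → (∀ {i} → i < n → f i ≈ 0#) → ∑ (upTo n) f ≈ 0#
  ∑-upTo-zero n eq = trans (∑-upTo-cong n eq) (∑-zero (upTo n))

  𝟙-yes : {A : Set ℓ₁} (A? : Dec A) (z : Carrier) → A → 𝟙 (does A?) * z ≈ z
  𝟙-yes (yes _) z _ = *-identityˡ z
  𝟙-yes (no ¬a) z a with () ← ¬a a

  𝟙-no : {A : Set ℓ₁} (A? : Dec A) (z : Carrier) → ¬ A → 𝟙 (does A?) * z ≈ 0#
  𝟙-no (yes a) z ¬a with () ← ¬a a
  𝟙-no (no _)  z _  = zeroˡ z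

  ∑-upTo-δ : ∀ n j (f : ℕ → Carrier) → j < n →
             ∑ (upTo n) (λ i → 𝟙 (does (j ℕ.≟ i)) * f i) ≈ f j
  ∑-upTo-δ (suc n) zero f _ = begin
    ∑ (upTo (suc n)) (λ i → 𝟙 (does (0 ℕ.≟ i)) * f i) ≈⟨ ∑-upTo-sucˡ n _ ⟩
    1# * f 0 + ∑ (upTo n) (λ i → 0# * f (suc i))      ≈⟨ +-cong (*-identityˡ _)
                                                          (∑-upTo-zero n (λ _ → zeroˡ _)) ⟩
    f 0 + 0#                                          ≈⟨ +-identityʳ _ ⟩
    f 0                                               ∎
  ∑-upTo-δ (suc n) (suc j) f (s≤s j<n) = begin
    ∑ (upTo (suc n)) (λ i → 𝟙 (does (suc j ℕ.≟ i)) * f i)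
      ≈⟨ ∑-upTo-sucˡ n _ ⟩
    0# * f 0 + ∑ (upTo n) (λ i → 𝟙 (does (j ℕ.≟ i)) * f (suc i))
      ≈⟨ +-cong (zeroˡ _) (∑-upTo-δ n j (f ∘ suc) j<n) ⟩
    0# + f (suc j)
      ≈⟨ +-identityˡ _ ⟩
    f (suc j)
      ∎

  ∑-⋯-δ : ∀ lo hi j (f : ℕ → Carrier) → lo ≤ j → j ≤ hi →
          ∑ [ lo ⋯ hi ] (λ k → 𝟙 (does (j ℕ.≟ k)) * f k) ≈ f j
  ∑-⋯-δ lo hi j f lo≤j j≤hi with ℕ.m≤n⇒∃[o]m+o≡n lo≤j
  ... | i , ≡.refl = begin
    ∑ [ lo ⋯ hi ] (λ k → 𝟙 (does (lo ℕ.+ i ℕ.≟ k)) * f k)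
      ≈⟨ ∑-⋯ lo hi _ ⟩
    ∑ (upTo n) (λ l → 𝟙 (does (lo ℕ.+ i ℕ.≟ lo ℕ.+ l)) * f (lo ℕ.+ l))
      ≈⟨ ∑-cong (upTo n) (λ l → *-congʳ (reflexive (≡.cong 𝟙 (shift lo l)))) ⟩
    ∑ (upTo n) (λ l → 𝟙 (does (i ℕ.≟ l)) * f (lo ℕ.+ l))
      ≈⟨ ∑-upTo-δ n i (λ l → f (lo ℕ.+ l)) i<n ⟩
    f (lo ℕ.+ i)
      ∎
    where
    n = suc hi ∸ lo
    i<n : i < n
    i<n = ℕ.m+n≤o⇒m≤o∸n (suc i)
      (s≤s (ℕ.≤-trans (ℕ.≤-reflexive (ℕ.+-comm i lo)) j≤hi))
    shift : ∀ m l → does (m ℕ.+ i ℕ.≟ m ℕ.+ l) ≡ does (i ℕ.≟ l)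
    shift zero    l = ≡.refl
    shift (suc m) l = shift m l

  -- Signed sums over subsets and Möbius inversion

  ∑-subsets-outside : (E : Subset N) (f : Subset (suc N) → Carrier) →
                      ∑ (subsets (outside ∷ E)) f ≈ ∑ (subsets E) (f ∘ (outside ∷_))
  ∑-subsets-outside E f = ∑-map (outside ∷_) (subsets E) f

  ∑-subsets-inside : (E : Subset N) (f : Subset (suc N) → Carrier) →
                     ∑ (subsets (inside ∷ E)) f ≈
                     ∑ (subsets E) (f ∘ (outside ∷_)) + ∑ (subsets E) (f ∘ (inside ∷_))
  ∑-subsets-inside E f = trans (∑-++ (map (outside ∷_) (subsets E)) _ f)
    (+-cong (∑-map (outside ∷_) (subsets E) f) (∑-map (inside ∷_) (subsets E) f))

  ∑-subsets-cong : (E : Subset N) {f g : Subset N → Carrier} →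
                   (∀ A → A ⊆ E → f A ≈ g A) → ∑ (subsets E) f ≈ ∑ (subsets E) g
  ∑-subsets-cong E eq = ∑-cong-All (All.map {P = _⊆ E} (λ {A} → eq A) (subsets-⊆ E))

  sign : Subset N → Carrier
  sign B = (- 1#) ^ ∣ B ∣

  flip-sign : ∀ z (B : Subset N) → z * sign (inside ∷ B) ≈ - (z * sign B)
  flip-sign z B = begin
    z * (- 1# * sign B) ≈⟨ *-congˡ (-1*x≈-x _) ⟩
    z * - sign B        ≈⟨ -‿distribʳ-* z _ ⟨
    - (z * sign B)      ∎

  -- Toggling `e` pairs off the subsets of `E`: `H` agrees on a pair and the signs are opposite. The
  -- induction only moves to the position of `e`.
  signed-sum-vanishes : (E : Subset N) (H : Subset N → Carrier) {e : Fin N} → e ∈ E →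
                        (∀ B → H (B ∪ ⁅ e ⁆) ≈ H B) →
                        ∑ (subsets E) (λ B → H B * sign B) ≈ 0#
  signed-sum-vanishes (inside ∷ E) H {zero} here eq = begin
    ∑ (subsets (inside ∷ E)) (λ B → H B * sign B)
      ≈⟨ ∑-subsets-inside E _ ⟩
    S₀ + ∑ (subsets E) (λ B → H (inside ∷ B) * sign (inside ∷ B))
      ≈⟨ +-congˡ (∑-cong (subsets E) λ B → trans (flip-sign _ B) (-‿cong (*-congʳ (swap B)))) ⟩
    S₀ + ∑ (subsets E) (λ B → - (H (outside ∷ B) * sign B))
      ≈⟨ +-congˡ (∑-neg (subsets E) _) ⟩
    S₀ + - S₀
      ≈⟨ -‿inverseʳ S₀ ⟩
    0#
      ∎
    where
    S₀ = ∑ (subsets E) (λ B → H (outside ∷ B) * sign B)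
    swap : ∀ B → H (inside ∷ B) ≈ H (outside ∷ B)
    swap B = trans (reflexive (≡.cong (λ C → H (inside ∷ C)) (≡.sym (∪-identityʳ B))))
                   (eq (outside ∷ B))
  signed-sum-vanishes (outside ∷ E) H {suc e} (there e∈E) eq =
    trans (∑-subsets-outside E _)
      (signed-sum-vanishes E (H ∘ (outside ∷_)) e∈E (eq ∘ (outside ∷_)))
  signed-sum-vanishes (inside ∷ E) H {suc e} (there e∈E) eq = begin
    ∑ (subsets (inside ∷ E)) (λ B → H B * sign B)
      ≈⟨ ∑-subsets-inside E _ ⟩
    ∑ (subsets E) (λ B → H (outside ∷ B) * sign B) +
    ∑ (subsets E) (λ B → H (inside ∷ B) * sign (inside ∷ B))
      ≈⟨ +-cong (signed-sum-vanishes E (H ∘ (outside ∷_)) e∈E (eq ∘ (outside ∷_)))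
           (trans (∑-cong (subsets E) λ B → flip-sign _ B) (∑-neg (subsets E) _)) ⟩
    0# + - ∑ (subsets E) (λ B → H (inside ∷ B) * sign B)
      ≈⟨ +-congˡ (-‿cong (signed-sum-vanishes E (H ∘ (inside ∷_)) e∈E (eq ∘ (inside ∷_)))) ⟩
    0# + - 0#
      ≈⟨ -‿inverseʳ 0# ⟩
    0#
      ∎

  -- For `X ⊆ E` this is the upward Möbius transform in the Boolean lattice: `B ∪ X` runs through
  -- the sets between `X` and `E`, and `B` is what is added to `X`.
  möbius : (Subset N → Carrier) → Subset N → Subset N → Carrier
  möbius F E X = ∑ (subsets (E ─ X)) λ B → F (B ∪ X) * sign B

  möbius-outside-outside : ∀ F (E X : Subset N) →
    möbius F (outside ∷ E) (outside ∷ X) ≈ möbius (F ∘ (outside ∷_)) E X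
  möbius-outside-outside F E X = ∑-subsets-outside (E ─ X) _

  möbius-inside-inside : ∀ F (E X : Subset N) →
    möbius F (inside ∷ E) (inside ∷ X) ≈ möbius (F ∘ (inside ∷_)) E X
  möbius-inside-inside F E X = ∑-subsets-outside (E ─ X) _

  möbius-inside-outside : ∀ F (E X : Subset N) →
    möbius F (inside ∷ E) (outside ∷ X) ≈
    möbius (F ∘ (outside ∷_)) E X - möbius (F ∘ (inside ∷_)) E X
  möbius-inside-outside F E X = trans (∑-subsets-inside (E ─ X) _)
    (+-congˡ (trans (∑-cong (subsets (E ─ X)) λ B → flip-sign _ B) (∑-neg (subsets (E ─ X)) _)))

  -- The Boolean step of möbius-inversion, with p - q the coefficient of X and q
  -- that of X with the new element.
  regroup : ∀ p q s t → (p - q) * s + q * (s + t) ≈ p * s + q * t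
  regroup p q s t = begin
    (p - q) * s + q * (s + t)           ≈⟨ +-cong (distribʳ s p (- q)) (distribˡ q s t) ⟩
    p * s + - q * s + (q * s + q * t)   ≈⟨ +-assoc _ _ _ ⟩
    p * s + (- q * s + (q * s + q * t)) ≈⟨ +-congˡ (+-assoc _ _ _) ⟨
    p * s + (- q * s + q * s + q * t)   ≈⟨ +-congˡ (+-congʳ (distribʳ s (- q) q)) ⟨
    p * s + ((- q + q) * s + q * t)     ≈⟨ +-congˡ (+-congʳ (*-congʳ (-‿inverseˡ q))) ⟩
    p * s + (0# * s + q * t)            ≈⟨ +-congˡ (+-congʳ (zeroˡ s)) ⟩
    p * s + (0# + q * t)                ≈⟨ +-congˡ (+-identityˡ _) ⟩
    p * s + q * t                       ∎

  -- Comparing the factors of `w A`, the claim is that the values `möbius F E X` over `A ⊆ X ⊆ E`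
  -- add up to `F A`. The induction treats one element of `E` at a time, so only the two-element
  -- lattice has to be inverted.
  möbius-inversion : (E : Subset N) (F w : Subset N → Carrier) →
    ∑ (subsets E) (λ A → F A * w A) ≈
    ∑ (subsets E) (λ X → möbius F E X * ∑ (subsets X) w)
  möbius-inversion [] F w = begin
    F [] * w [] + 0#                             ≈⟨ +-congʳ (*-cong (*-identityʳ _) (+-identityʳ _)) ⟨
    F [] * 1# * (w [] + 0#) + 0#                 ≈⟨ +-congʳ (*-congʳ (+-identityʳ _)) ⟨
    (F [] * 1# + 0#) * (w [] + 0#) + 0#          ∎
  möbius-inversion (outside ∷ E) F w = begin
    ∑ (subsets (outside ∷ E)) (λ A → F A * w A)
      ≈⟨ ∑-subsets-outside E _ ⟩
    ∑ (subsets E) (λ A → F (outside ∷ A) * w (outside ∷ A))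
      ≈⟨ möbius-inversion E (F ∘ (outside ∷_)) (w ∘ (outside ∷_)) ⟩
    ∑ (subsets E) (λ X → möbius (F ∘ (outside ∷_)) E X * ∑ (subsets X) (w ∘ (outside ∷_)))
      ≈⟨ ∑-cong (subsets E) (λ X →
           *-cong (möbius-outside-outside F E X) (∑-subsets-outside X w)) ⟨
    ∑ (subsets E) (λ X → möbius F (outside ∷ E) (outside ∷ X) * ∑ (subsets (outside ∷ X)) w)
      ≈⟨ ∑-subsets-outside E _ ⟨
    ∑ (subsets (outside ∷ E)) (λ X → möbius F (outside ∷ E) X * ∑ (subsets X) w)
      ∎
  möbius-inversion (inside ∷ E) F w = begin
    ∑ (subsets (inside ∷ E)) (λ A → F A * w A)
      ≈⟨ ∑-subsets-inside E _ ⟩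
    ∑ (subsets E) (λ A → F₀ A * w₀ A) + ∑ (subsets E) (λ A → F₁ A * w₁ A)
      ≈⟨ +-cong (möbius-inversion E F₀ w₀) (möbius-inversion E F₁ w₁) ⟩
    ∑ (subsets E) (λ X → D₀ X * W₀ X) + ∑ (subsets E) (λ X → D₁ X * W₁ X)
      ≈⟨ ∑-+ (subsets E) _ _ ⟨
    ∑ (subsets E) (λ X → D₀ X * W₀ X + D₁ X * W₁ X)
      ≈⟨ ∑-cong (subsets E) (λ X → regroup (D₀ X) (D₁ X) (W₀ X) (W₁ X)) ⟨
    ∑ (subsets E) (λ X → (D₀ X - D₁ X) * W₀ X + D₁ X * (W₀ X + W₁ X))
      ≈⟨ ∑-+ (subsets E) _ _ ⟩
    ∑ (subsets E) (λ X → (D₀ X - D₁ X) * W₀ X) + ∑ (subsets E) (λ X → D₁ X * (W₀ X + W₁ X))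
      ≈⟨ +-cong
           (∑-cong (subsets E) λ X →
             *-cong (möbius-inside-outside F E X) (∑-subsets-outside X w))
           (∑-cong (subsets E) λ X →
             *-cong (möbius-inside-inside F E X) (∑-subsets-inside X w)) ⟨
    ∑ (subsets E) (λ X → möbius F (inside ∷ E) (outside ∷ X) * ∑ (subsets (outside ∷ X)) w) +
    ∑ (subsets E) (λ X → möbius F (inside ∷ E) (inside ∷ X) * ∑ (subsets (inside ∷ X)) w)
      ≈⟨ ∑-subsets-inside E _ ⟨
    ∑ (subsets (inside ∷ E)) (λ X → möbius F (inside ∷ E) X * ∑ (subsets X) w)
      ∎
    where
    F₀ = F ∘ (outside ∷_)
    F₁ = F ∘ (inside ∷_)
    w₀ = w ∘ (outside ∷_)
    w₁ = w ∘ (inside ∷_)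
    D₀ = möbius F₀ E
    D₁ = möbius F₁ E
    W₀ = λ X → ∑ (subsets X) w₀
    W₁ = λ X → ∑ (subsets X) w₁

  -- binomialSum n f = ∑ s, (n choose s) f(s).
  binomialSum : ℕ → (ℕ → Carrier) → Carrier
  binomialSum zero    f = f 0
  binomialSum (suc n) f = binomialSum n f + binomialSum n (f ∘ suc)

  ∑-subsets-card : (E : Subset N) (f : ℕ → Carrier) →
                   ∑ (subsets E) (f ∘ ∣_∣) ≈ binomialSum ∣ E ∣ f
  ∑-subsets-card []            f = +-identityʳ _
  ∑-subsets-card (outside ∷ E) f = trans (∑-subsets-outside E _) (∑-subsets-card E f)
  ∑-subsets-card (inside  ∷ E) f = trans (∑-subsets-inside E _)
    (+-cong (∑-subsets-card E f) (∑-subsets-card E (f ∘ suc)))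

  -- The polynomials τ

  binomialSum-*ˡ : ∀ z n (f : ℕ → Carrier) →
                   binomialSum n (λ s → z * f s) ≈ z * binomialSum n f
  binomialSum-*ˡ z zero    f = refl
  binomialSum-*ˡ z (suc n) f =
    trans (+-cong (binomialSum-*ˡ z n f) (binomialSum-*ˡ z n (f ∘ suc))) (sym (distribˡ z _ _))

  1+[y-1]≈y : ∀ y → 1# + (y - 1#) ≈ y
  1+[y-1]≈y y = trans (sym (+-assoc 1# y (- 1#))) (xyx⁻¹≈y 1# y)

  -- The binomial theorem for `1 + (y - 1)`.
  binomialSum-^ : ∀ y n → binomialSum n ((y - 1#) ^_) ≈ y ^ n
  binomialSum-^ y zero    = refl
  binomialSum-^ y (suc n) = begin
    binomialSum n ((y - 1#) ^_) + binomialSum n (λ s → (y - 1#) * (y - 1#) ^ s)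
      ≈⟨ +-congˡ (binomialSum-*ˡ (y - 1#) n _) ⟩
    S + (y - 1#) * S         ≈⟨ +-congʳ (*-identityˡ S) ⟨
    1# * S + (y - 1#) * S    ≈⟨ distribʳ S 1# (y - 1#) ⟨
    (1# + (y - 1#)) * S      ≈⟨ *-cong (1+[y-1]≈y y) (binomialSum-^ y n) ⟩
    y * y ^ n                ∎
    where
    S = binomialSum n ((y - 1#) ^_)

  -- The weight of a set of size `s` at level `i`. The indicator is essential: for `s ≤ i` the
  -- truncated exponent is 0 and the bare power would be 1.
  excess : Carrier → ℕ → ℕ → Carrier
  excess b i s = 𝟙 (i <ᵇ s) * b ^ (s ∸ suc i)

  binomialSum-excess≈0 : ∀ b {i n} → n ≤ i → binomialSum n (excess b i) ≈ 0#
  binomialSum-excess≈0 b z≤n       = zeroˡ _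
  binomialSum-excess≈0 b (s≤s n≤i) = trans
    (+-cong (binomialSum-excess≈0 b (ℕ.m≤n⇒m≤1+n n≤i)) (binomialSum-excess≈0 b n≤i))
    (+-identityˡ 0#)

  -- Makes the coefficient a function of `i` and `α ∸ j` alone, the form to which Pascal's rule
  -- applies.
  τ-coefficient : ∀ i {α j} → j ≤ α →
                  (α ℕ.+ suc i ∸ 1 ∸ j) C (α ∸ j) ≡ (α ∸ j ℕ.+ i) C (α ∸ j)
  τ-coefficient i {α} {j} j≤α = ≡.cong (_C (α ∸ j))
    (≡.trans (≡.cong (λ k → k ∸ 1 ∸ j) (ℕ.+-suc α i)) (ℕ.+-∸-comm i j≤α))

  τ-sum : ∀ i α y → τ (+ suc i) (+ α) y ≈
          ∑ (upTo (suc α)) (λ j → ((α ∸ j ℕ.+ i) C (α ∸ j)) · (y ^ j))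
  τ-sum i α y = ∑-upTo-cong (suc α) λ {j} j<1+α →
    ×-congˡ {y ^ j} (τ-coefficient i (ℕ.≤-pred j<1+α))

  τ-0 : ∀ i y → τ (+ suc i) (+ 0) y ≈ 1#
  τ-0 i y = trans (τ-sum i 0 y) (trans (+-identityʳ _) (+-identityʳ _))

  -- The top power has coefficient 1. Splitting it off leaves the index range of `τ` at `α`.
  τ-sucʳ : ∀ i α y → τ (+ suc i) (+ suc α) y ≈
           ∑ (upTo (suc α)) (λ j → ((suc (α ∸ j) ℕ.+ i) C suc (α ∸ j)) · (y ^ j)) + y ^ suc α
  τ-sucʳ i α y = begin
    τ (+ suc i) (+ suc α) y
      ≈⟨ τ-sum i (suc α) y ⟩
    ∑ (upTo (suc (suc α))) (λ j → f (suc α ∸ j) · (y ^ j))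
      ≈⟨ ∑-upTo-sucʳ (suc α) _ ⟩
    ∑ (upTo (suc α)) (λ j → f (suc α ∸ j) · (y ^ j)) + f (α ∸ α) · (y ^ suc α)
      ≈⟨ +-cong
           (∑-upTo-cong (suc α) λ {j} j<1+α →
             ×-congˡ {y ^ j} (≡.cong f (ℕ.+-∸-assoc 1 (ℕ.≤-pred j<1+α))))
           (trans (×-congˡ {y ^ suc α} (≡.cong f (ℕ.n∸n≡0 α))) (+-identityʳ _)) ⟩
    ∑ (upTo (suc α)) (λ j → f (suc (α ∸ j)) · (y ^ j)) + y ^ suc α
      ∎
    where
    f : ℕ → ℕ
    f d = (d ℕ.+ i) C d

  -- For d = 1 all coefficients are 1, and `τ` is a geometric sum.
  τ-1-suc : ∀ α y → τ (+ 1) (+ suc α) y ≈ τ (+ 1) (+ α) y + y ^ suc α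
  τ-1-suc α y = begin
    τ (+ 1) (+ suc α) y
      ≈⟨ τ-sucʳ 0 α y ⟩
    ∑ (upTo (suc α)) (λ j → f (suc (α ∸ j)) · (y ^ j)) + y ^ suc α
      ≈⟨ +-congʳ (∑-cong (upTo (suc α)) λ j →
           ×-congˡ {y ^ j} (≡.trans (f≡1 (suc (α ∸ j))) (≡.sym (f≡1 (α ∸ j))))) ⟩
    ∑ (upTo (suc α)) (λ j → f (α ∸ j) · (y ^ j)) + y ^ suc α
      ≈⟨ +-congʳ (τ-sum 0 α y) ⟨
    τ (+ 1) (+ α) y + y ^ suc α
      ∎
    where
    f : ℕ → ℕ
    f d = (d ℕ.+ 0) C d
    f≡1 : ∀ d → f d ≡ 1
    f≡1 d = ≡.trans (≡.cong (_C d) (ℕ.+-identityʳ d)) (nCn≡1 d)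

  -- Pascal's rule, coefficient by coefficient; the extra top power joins the sum that reaches
  -- degree `suc α`.
  τ-suc-suc : ∀ i α y → τ (+ suc (suc i)) (+ suc α) y ≈
              τ (+ suc (suc i)) (+ α) y + τ (+ suc i) (+ suc α) y
  τ-suc-suc i α y = begin
    τ (+ suc (suc i)) (+ suc α) y
      ≈⟨ τ-sucʳ (suc i) α y ⟩
    ∑ (upTo (suc α)) (λ j → f (suc i) (suc (α ∸ j)) · (y ^ j)) + y ^ suc α
      ≈⟨ +-congʳ (∑-cong (upTo (suc α)) λ j → trans
           (×-congˡ {y ^ j} (pascal (α ∸ j)))
           (×-homo-+ (y ^ j) (f (suc i) (α ∸ j)) (f i (suc (α ∸ j))))) ⟩
    ∑ (upTo (suc α)) (λ j → f (suc i) (α ∸ j) · (y ^ j) + f i (suc (α ∸ j)) · (y ^ j)) + y ^ suc α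
      ≈⟨ +-congʳ (∑-+ (upTo (suc α)) _ _) ⟩
    ∑ (upTo (suc α)) (λ j → f (suc i) (α ∸ j) · (y ^ j)) +
    ∑ (upTo (suc α)) (λ j → f i (suc (α ∸ j)) · (y ^ j)) + y ^ suc α
      ≈⟨ +-assoc _ _ _ ⟩
    ∑ (upTo (suc α)) (λ j → f (suc i) (α ∸ j) · (y ^ j)) +
    (∑ (upTo (suc α)) (λ j → f i (suc (α ∸ j)) · (y ^ j)) + y ^ suc α)
      ≈⟨ +-cong (τ-sum (suc i) α y) (τ-sucʳ i α y) ⟨
    τ (+ suc (suc i)) (+ α) y + τ (+ suc i) (+ suc α) y
      ∎
    where
    f : ℕ → ℕ → ℕ
    f i d = (d ℕ.+ i) C d
    pascal : ∀ d → f (suc i) (suc d) ≡ f (suc i) d ℕ.+ f i (suc d)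
    pascal d = ≡.trans (≡.sym (nCk+nC[k+1]≡[n+1]C[k+1] (d ℕ.+ suc i) d))
      (≡.cong (λ n → f (suc i) d ℕ.+ n C suc d) (ℕ.+-suc d i))

  -- Both sides obey the same recursion. Shifting the size by one turns `excess b (suc i)` into
  -- `excess b i`, so unfolding `binomialSum` once lowers either `α` or `i`, as `τ-suc-suc` does.
  -- For `i = 0` the shift leaves plain powers of `b`, which sum to a power of `y`.
  binomialSum-excess : ∀ y i α → binomialSum (suc i ℕ.+ α) (excess (y - 1#) i) ≈ τ (+ suc i) (+ α) y
  binomialSum-excess y zero zero = begin
    0# * 1# + 1# * 1#   ≈⟨ +-cong (zeroˡ 1#) (*-identityˡ 1#) ⟩
    0# + 1#             ≈⟨ +-identityˡ 1# ⟩
    1#                  ≈⟨ τ-0 0 y ⟨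
    τ (+ 1) (+ 0) y     ∎
  binomialSum-excess y zero (suc α) = begin
    binomialSum (suc α) (excess b 0) + binomialSum (suc α) (λ s → 1# * b ^ s)
      ≈⟨ +-cong (binomialSum-excess y 0 α)
           (trans (binomialSum-*ˡ 1# (suc α) (b ^_))
             (trans (*-identityˡ _) (binomialSum-^ y (suc α)))) ⟩
    τ (+ 1) (+ α) y + y ^ suc α
      ≈⟨ τ-1-suc α y ⟨
    τ (+ 1) (+ suc α) y
      ∎
    where b = y - 1#
  binomialSum-excess y (suc i) zero = begin
    binomialSum (suc i ℕ.+ 0) (excess b (suc i)) + binomialSum (suc i ℕ.+ 0) (excess b i)
      ≈⟨ +-cong (binomialSum-excess≈0 b (ℕ.≤-reflexive (ℕ.+-identityʳ (suc i))))
                (binomialSum-excess y i 0) ⟩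
    0# + τ (+ suc i) (+ 0) y    ≈⟨ +-identityˡ _ ⟩
    τ (+ suc i) (+ 0) y         ≈⟨ τ-0 i y ⟩
    1#                          ≈⟨ τ-0 (suc i) y ⟨
    τ (+ suc (suc i)) (+ 0) y   ∎
    where b = y - 1#
  binomialSum-excess y (suc i) (suc α) = begin
    binomialSum (suc i ℕ.+ suc α) (excess b (suc i)) + binomialSum (suc i ℕ.+ suc α) (excess b i)
      ≡⟨ ≡.cong (λ n → binomialSum n (excess b (suc i)) + binomialSum (suc i ℕ.+ suc α) (excess b i))
           (ℕ.+-suc (suc i) α) ⟩
    binomialSum (suc (suc i) ℕ.+ α) (excess b (suc i)) + binomialSum (suc i ℕ.+ suc α) (excess b i)
      ≈⟨ +-cong (binomialSum-excess y (suc i) α) (binomialSum-excess y i (suc α)) ⟩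
    τ (+ suc (suc i)) (+ α) y + τ (+ suc i) (+ suc α) y
      ≈⟨ τ-suc-suc i α y ⟨
    τ (+ suc (suc i)) (+ suc α) y
      ∎
    where b = y - 1#

  -- For `m ≤ i` the second argument is negative and `τ` is 0 by convention, in agreement with the
  -- sum, where no size exceeds `i`.
  τ-⊖ : ∀ y i m → τ (+ suc i) (m ℤ.⊖ suc i) y ≈ binomialSum m (excess (y - 1#) i)
  τ-⊖ y i m with ℕ.≤-<-connex m i
  ... | inj₁ m≤i = begin
    τ (+ suc i) (m ℤ.⊖ suc i) y         ≡⟨ ≡.cong (λ j → τ (+ suc i) j y) (ℤ.⊖-< (s≤s m≤i)) ⟩
    τ (+ suc i) (ℤ.- + (suc i ∸ m)) y   ≡⟨ ≡.cong (λ d → τ (+ suc i) (ℤ.- + d) y) (ℕ.+-∸-assoc 1 m≤i) ⟩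
    -- Exposing the successor in the difference makes its negative compute to `-[1+_]`, where the
    -- default clause of `τ` applies.
    0#                                  ≈⟨ binomialSum-excess≈0 (y - 1#) m≤i ⟨
    binomialSum m (excess (y - 1#) i)   ∎
  ... | inj₂ i<m = begin
    τ (+ suc i) (m ℤ.⊖ suc i) y
      ≡⟨ ≡.cong (λ j → τ (+ suc i) j y) (ℤ.⊖-≥ i<m) ⟩
    τ (+ suc i) (+ (m ∸ suc i)) y
      ≈⟨ binomialSum-excess y i (m ∸ suc i) ⟨
    binomialSum (suc i ℕ.+ (m ∸ suc i)) (excess (y - 1#) i)
      ≡⟨ ≡.cong (λ n → binomialSum n (excess (y - 1#) i)) (ℕ.m+[n∸m]≡n i<m) ⟩
    binomialSum m (excess (y - 1#) i)
      ∎

  -- Expansion of a rank-size term by levels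

  -- The indicators in excess and rk≤ use _<ᵇ_, so that lowering i, s and ρ
  -- together by one is a definitional equality.
  rank-size-expansion : ∀ a b u → a * b ≈ 1# + u → ∀ {r s ρ} → ρ ≤ r → ρ ≤ s →
    a ^ (r ∸ ρ) * b ^ (s ∸ ρ) ≈
    a ^ (r ∸ (r ⊓ s)) * b ^ (s ∸ (r ⊓ s)) +
    u * ∑ (upTo r) (λ i → a ^ (r ∸ suc i) * (𝟙 (ρ <ᵇ suc i) * excess b i s))
  rank-size-expansion a b u ab {zero} z≤n z≤n =
    sym (trans (+-congˡ (zeroʳ u)) (+-identityʳ _))
  rank-size-expansion a b u ab {suc r} {zero} z≤n z≤n =
    sym (trans (+-congˡ (trans (*-congˡ (∑-upTo-zero (suc r) λ _ →
      trans (*-congˡ (trans (*-congˡ (zeroˡ _)) (zeroʳ _))) (zeroʳ _))) (zeroʳ u))) (+-identityʳ _))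
  -- With both exponents positive, one factor `a * b` becomes `1# + u`: the 1 leads to the recursive
  -- call, and `u` supplies the term of level 0.
  rank-size-expansion a b u ab {suc r} {suc s} z≤n z≤n = begin
    a * a ^ r * (b * b ^ s)                       ≈⟨ *-CS.interchange a _ b _ ⟩
    a * b * p                                     ≈⟨ *-congʳ ab ⟩
    (1# + u) * p                                  ≈⟨ distribʳ p 1# u ⟩
    1# * p + u * p                                ≈⟨ +-congʳ (*-identityˡ p) ⟩
    p + u * p                                     ≈⟨ +-congʳ (rank-size-expansion a b u ab {r} {s} z≤n z≤n) ⟩
    v + u * S + u * p                             ≈⟨ +-assoc v _ _ ⟩
    v + (u * S + u * p)                           ≈⟨ +-congˡ (distribˡ u S p) ⟨
    v + u * (S + p)                               ≈⟨ +-congˡ (*-congˡ (+-comm S p)) ⟩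
    v + u * (p + S)                               ≈⟨ +-congˡ (*-congˡ (+-congʳ (*-congˡ (trans (*-identityˡ _) (*-identityˡ _))))) ⟨
    v + u * (a ^ r * (1# * (1# * b ^ s)) + S)     ≈⟨ +-congˡ (*-congˡ (∑-upTo-sucˡ r _)) ⟨
    v + u * ∑ (upTo (suc r)) (λ i → a ^ (suc r ∸ suc i) * (1# * excess b i (suc s))) ∎
    where
    p = a ^ r * b ^ s
    v = a ^ (r ∸ (r ⊓ s)) * b ^ (s ∸ (r ⊓ s))
    S = ∑ (upTo r) (λ i → a ^ (r ∸ suc i) * (1# * excess b i s))
  rank-size-expansion a b u ab {suc r} {suc s} {suc ρ} (s≤s ρ≤r) (s≤s ρ≤s) = begin
    a ^ (r ∸ ρ) * b ^ (s ∸ ρ)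
      ≈⟨ rank-size-expansion a b u ab ρ≤r ρ≤s ⟩
    v + u * S
      ≈⟨ +-congˡ (*-congˡ (+-identityˡ S)) ⟨
    v + u * (0# + S)
      -- Level 0 lies below the rank `suc ρ`, so its indicator is 0.
      ≈⟨ +-congˡ (*-congˡ (+-congʳ (trans (*-congˡ (zeroˡ _)) (zeroʳ _)))) ⟨
    v + u * (a ^ r * (0# * excess b 0 (suc s)) + S)
      ≈⟨ +-congˡ (*-congˡ (∑-upTo-sucˡ r _)) ⟨
    v + u * ∑ (upTo (suc r)) (λ i → a ^ (suc r ∸ suc i) * (𝟙 (suc ρ <ᵇ suc i) * excess b i (suc s)))
      ∎
    where
    v = a ^ (r ∸ (r ⊓ s)) * b ^ (s ∸ (r ⊓ s))
    S = ∑ (upTo r) (λ i → a ^ (r ∸ suc i) * (𝟙 (ρ <ᵇ suc i) * excess b i s))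

  -- Möbius invariants of truncations as signed sums

  𝟙-cong : {A : Set ℓ₁} (A? : Dec A) {y z : Carrier} → (A → y ≈ z) →
           𝟙 (does A?) * y ≈ 𝟙 (does A?) * z
  𝟙-cong (yes a) eq = *-congˡ (eq a)
  𝟙-cong (no _)  eq = trans (zeroˡ _) (sym (zeroˡ _))

  𝟙-guard : {A : Set ℓ₁} (A? : Dec A) {y z : Carrier} → (A → y ≈ z) → (¬ A → y ≈ 0#) →
            y ≈ 𝟙 (does A?) * z
  𝟙-guard (yes a) eq _      = trans (eq a) (sym (*-identityˡ _))
  𝟙-guard (no ¬a) _  vanish = trans (vanish ¬a) (sym (zeroˡ _))

  𝟙-∧ : ∀ p q z → 𝟙 (p ∧ q) * z ≈ 𝟙 p * (𝟙 q * z)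
  𝟙-∧ true  q z = sym (*-identityˡ _)
  𝟙-∧ false q z = trans (zeroˡ z) (sym (zeroˡ _))

  -- Powers of 0# select the sets that span the truncation; they are written as
  -- all sets minus those of rank at most t, since the signs of all sets cancel.
  truncated-term : ∀ t {q n} → q ≤ n →
    (- 1#) ^ t * (0# ^ (suc t ∸ (suc t ⊓ q)) * (- 1#) ^ (n ∸ (suc t ⊓ q))) ≈
    𝟙 (q <ᵇ suc t) * (- 1#) ^ n - (- 1#) ^ n
  truncated-term t {q} {n} q≤n with ℕ.≤-<-connex q t
  ... | inj₁ q≤t = begin
    (- 1#) ^ t * (0# ^ (suc t ∸ (suc t ⊓ q)) * ε)
      ≡⟨ ≡.cong (λ k → (- 1#) ^ t * (0# ^ k * ε)) (≡.trans
           (≡.cong (suc t ∸_) (ℕ.m≥n⇒m⊓n≡n (ℕ.m≤n⇒m≤1+n q≤t))) (ℕ.+-∸-assoc 1 q≤t)) ⟩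
    (- 1#) ^ t * (0# * 0# ^ (t ∸ q) * ε)
      ≈⟨ *-congˡ (*-congʳ (zeroˡ _)) ⟩
    (- 1#) ^ t * (0# * ε)
      ≈⟨ trans (*-congˡ (zeroˡ ε)) (zeroʳ _) ⟩
    0#
      ≈⟨ x≈y⇒x∙y⁻¹≈ε (𝟙-yes (q ℕ.<? suc t) _ (s≤s q≤t)) ⟨
    𝟙 (q <ᵇ suc t) * (- 1#) ^ n - (- 1#) ^ n
      ∎
    where ε = (- 1#) ^ (n ∸ (suc t ⊓ q))
  ... | inj₂ t<q = begin
    (- 1#) ^ t * (0# ^ (suc t ∸ (suc t ⊓ q)) * (- 1#) ^ (n ∸ (suc t ⊓ q)))
      ≡⟨ ≡.cong (λ k → (- 1#) ^ t * (0# ^ (suc t ∸ k) * (- 1#) ^ (n ∸ k))) (ℕ.m≤n⇒m⊓n≡m t<q) ⟩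
    (- 1#) ^ t * (0# ^ (t ∸ t) * (- 1#) ^ (n ∸ suc t))
      ≡⟨ ≡.cong (λ k → (- 1#) ^ t * (0# ^ k * (- 1#) ^ (n ∸ suc t))) (ℕ.n∸n≡0 t) ⟩
    (- 1#) ^ t * (1# * (- 1#) ^ (n ∸ suc t))
      ≈⟨ *-congˡ (*-identityˡ _) ⟩
    (- 1#) ^ t * (- 1#) ^ (n ∸ suc t)
      ≈⟨ -‿involutive _ ⟨
    - - ((- 1#) ^ t * (- 1#) ^ (n ∸ suc t))
      ≈⟨ -‿cong (trans (-‿distribˡ-* _ _) (*-congʳ (sym (-1*x≈-x _)))) ⟩
    - ((- 1#) ^ suc t * (- 1#) ^ (n ∸ suc t))
      ≈⟨ -‿cong (^-homo-* (- 1#) (suc t) (n ∸ suc t)) ⟨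
    - ((- 1#) ^ (suc t ℕ.+ (n ∸ suc t)))
      ≡⟨ ≡.cong (λ k → - ((- 1#) ^ k)) (ℕ.m+[n∸m]≡n (ℕ.≤-trans t<q q≤n)) ⟩
    - ((- 1#) ^ n)
      ≈⟨ +-identityˡ _ ⟨
    0# - (- 1#) ^ n
      ≈⟨ +-congʳ (𝟙-no (q ℕ.<? suc t) _ (ℕ.≤⇒≯ t<q)) ⟨
    𝟙 (q <ᵇ suc t) * (- 1#) ^ n - (- 1#) ^ n
      ∎

  ∑-sign≈0 : (E : Subset N) {e : Fin N} → e ∈ E → ∑ (subsets E) sign ≈ 0#
  ∑-sign≈0 E e∈E = trans (∑-cong (subsets E) λ B → sym (*-identityˡ (sign B)))
    (signed-sum-vanishes E (λ _ → 1#) e∈E (λ _ → refl))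

  -- Summing `truncated-term` leaves over the negated sum of all signs, which vanishes because the
  -- ground set has an element.
  signed-T-Trun : ∀ s t (M : Matroid N) → rank M ∸ s ≡ suc t →
    (∃ λ e → e ∈ ground M) →
    (- 1#) ^ t * T (Trun^ s M) 1# 0# ≈
    ∑ (subsets (ground M)) (λ B → 𝟙 (rk M B <ᵇ suc t) * sign B)
  signed-T-Trun {N} s t M rank≡ (_ , e∈E) = begin
    (- 1#) ^ t * T M′ 1# 0#
      ≡⟨ ≡.cong (λ E → (- 1#) ^ t * ∑ (subsets E) (term M′)) (ground-Trun s M) ⟩
    (- 1#) ^ t * ∑ S (term M′)
      ≈⟨ ∑-*ˡ _ S _ ⟨
    ∑ S (λ B → (- 1#) ^ t * term M′ B)
      ≈⟨ ∑-cong S each ⟩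
    ∑ S (λ B → 𝟙 (rk M B <ᵇ suc t) * sign B - sign B)
      ≈⟨ ∑-+ S _ _ ⟩
    ∑ S (λ B → 𝟙 (rk M B <ᵇ suc t) * sign B) + ∑ S (λ B → - sign B)
      ≈⟨ +-congˡ (trans (∑-neg S sign) (trans (-‿cong (∑-sign≈0 (ground M) e∈E)) -0#≈0#)) ⟩
    ∑ S (λ B → 𝟙 (rk M B <ᵇ suc t) * sign B) + 0#
      ≈⟨ +-identityʳ _ ⟩
    ∑ S (λ B → 𝟙 (rk M B <ᵇ suc t) * sign B)
      ∎
    where
    M′ = Trun^ s M
    S  = subsets (ground M)
    term : Matroid N → Subset N → Carrier
    term K B = (1# - 1#) ^ (rank K ∸ rk K B) * (0# - 1#) ^ (∣ B ∣ ∸ rk K B)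
    each : ∀ B → (- 1#) ^ t * term M′ B ≈ 𝟙 (rk M B <ᵇ suc t) * sign B - sign B
    each B = begin
      (- 1#) ^ t * term M′ B
        ≈⟨ *-congˡ (*-cong (^-congˡ (rank M′ ∸ rk M′ B) (-‿inverseʳ 1#))
                           (^-congˡ (∣ B ∣ ∸ rk M′ B) (+-identityˡ (- 1#)))) ⟩
      (- 1#) ^ t * (0# ^ (rank M′ ∸ rk M′ B) * (- 1#) ^ (∣ B ∣ ∸ rk M′ B))
        ≡⟨ ≡.cong₂ (λ k l → (- 1#) ^ t * (0# ^ (k ∸ l) * (- 1#) ^ (∣ B ∣ ∸ l)))
             (≡.trans (rank-Trun s M) rank≡)
             (≡.trans (rk-Trun s M B) (≡.cong (_⊓ rk M B) rank≡)) ⟩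
      (- 1#) ^ t * (0# ^ (suc t ∸ (suc t ⊓ rk M B)) * (- 1#) ^ (∣ B ∣ ∸ (suc t ⊓ rk M B)))
        ≈⟨ truncated-term t (rk-card M B) ⟩
      𝟙 (rk M B <ᵇ suc t) * sign B - sign B
        ∎

  -- Möbius coefficients of the rank bounds

  module _ (M : Matroid N) where
    rk≤ : ℕ → Subset N → Carrier
    rk≤ i A = 𝟙 (rk M A <ᵇ suc i)

    -- The c_i(X) of the opening comment.
    coefficient : ℕ → Subset N → Carrier
    coefficient i = möbius (rk≤ i) (ground M)

    -- Some element outside `X` is spanned by `X`; toggling it in `B` keeps the rank of `B ∪ X` and
    -- changes the sign.
    coefficient-non-flat : ∀ i {X} → X ⊆ ground M → ¬ IsFlat M X → coefficient i X ≈ 0#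
    coefficient-non-flat i {X} X⊆E ¬flat with non-flat⇒spanned M X⊆E ¬flat
    ... | e , e∈ , spanned = signed-sum-vanishes (ground M ─ X) (λ B → rk≤ i (B ∪ X)) e∈
      λ B → reflexive (≡.cong (λ k → 𝟙 (k <ᵇ suc i)) (rk-∪⁅⁆ M spanned B))

    coefficient-low : ∀ {i X} → i < rk M X → coefficient i X ≈ 0#
    coefficient-low {i} {X} i<rk = trans (∑-cong S λ B →
        𝟙-no (rk M (B ∪ X) ℕ.<? suc i) _ (ℕ.≤⇒≯ (ℕ.≤-trans i<rk (rk-mono M (q⊆p∪q B X)))))
      (∑-zero S)
      where S = subsets (ground M ─ X)

    -- A set `B` has rank at most `t` in `M / X` exactly when `B ∪ X` has rank at most `rk M X + t`
    -- in `M`. So `signed-T-Trun` for `M / X` yields the signed sum that defines the coefficient.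
    signed-T-Trun-/ : ∀ t {X} → rk M X ℕ.+ t < rank M →
      (- 1#) ^ t * T (Trun^ (rank M ∸ rk M X ∸ t ∸ 1) (M / X)) 1# 0# ≈
      coefficient (rk M X ℕ.+ t) X
    signed-T-Trun-/ t {X} k+t<r = trans
      (signed-T-Trun (r ∸ k ∸ t ∸ 1) t (M / X) rank≡
        (rk<rank⇒∃─ M (ℕ.≤-<-trans (ℕ.m≤m+n k t) k+t<r)))
      (∑-cong (subsets (ground M ─ X)) λ B → *-congʳ (reflexive (≡.cong 𝟙
        (<ᵇ-∸ k t (rk-mono M (q⊆p∪q B X))))))
      where
      r = rank M
      k = rk M X
      rank≡ : rank (M / X) ∸ (r ∸ k ∸ t ∸ 1) ≡ suc t
      -- The truncation removes `r ∸ k ∸ suc t` from the rank `r ∸ k`; as `k + t < r`, exactly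
      -- `suc t` is left.
      rank≡ = ≡.trans (≡.cong₂ _∸_ (rank-/ M X)
          (≡.trans (∸-∸-1 r k t) (≡.trans (≡.cong (r ∸_) (≡.sym (ℕ.+-suc k t)))
            (≡.sym (ℕ.∸-+-assoc r k (suc t))))))
        (ℕ.m∸[m∸n]≡n (ℕ.m+n≤o⇒m≤o∸n (suc t)
          (ℕ.≤-trans (s≤s (ℕ.≤-reflexive (ℕ.+-comm t k))) k+t<r)))

-- Flat numbers in terms of the coefficients

private
  module ℤΣ = SubsetSums ℤ.+-*-commutativeRing
  module ℤPoly = Polynomials ℤ.+-*-commutativeRing

^-ℤ : ∀ i n → i ℤ.^ n ≡ i ℤPoly.^ n
^-ℤ i zero    = ≡.refl
^-ℤ i (suc n) = ≡.cong (i ℤ.*_) (^-ℤ i n)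

-- Both filters become indicators, so that the sum runs over all subsets and can later be
-- interchanged with others. Under the indicator the rank of `X` is `k`, and `signed-T-Trun-/`
-- applies to each summand.
flatNumber-coefficient : (M : Matroid N) → ∀ t k m → k ℕ.+ t < rank M →
  flatNumber M t k m ≡
  ℤPoly.∑ (subsets (ground M)) λ X → ℤΣ.𝟙 (does (isFlat? M X)) ℤ.*
    (ℤΣ.𝟙 (does ((rk M X ℕ.≟ k) ×-dec (∣ X ∣ ℕ.≟ m))) ℤ.* ℤΣ.coefficient M (k ℕ.+ t) X)
flatNumber-coefficient {N} M t k m k+t<r = begin
  (ℤ.-1ℤ ℤ.^ t) ℤ.* ℤPoly.∑ (filter P? (flats M)) μ′
    ≡⟨ ≡.cong₂ ℤ._*_ (^-ℤ ℤ.-1ℤ t) (≡.trans (ℤΣ.∑-filter P? (flats M) μ′)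
         (ℤΣ.∑-filter (isFlat? M) S (λ X → place X ℤ.* μ′ X))) ⟩
  ε ℤ.* ℤPoly.∑ S (λ X → flat X ℤ.* (place X ℤ.* μ′ X))
    ≡⟨ ℤΣ.∑-*ˡ ε S _ ⟨
  ℤPoly.∑ S (λ X → ε ℤ.* (flat X ℤ.* (place X ℤ.* μ′ X)))
    ≡⟨ ℤΣ.∑-cong S (λ X → ≡.trans (x∙yz≈y∙xz ε (flat X) _)
         (≡.cong (flat X ℤ.*_) (≡.trans (x∙yz≈y∙xz ε (place X) (μ′ X)) (ℤΣ.𝟙-cong (P? X) (at X))))) ⟩
  ℤPoly.∑ S (λ X → flat X ℤ.* (place X ℤ.* ℤΣ.coefficient M (k ℕ.+ t) X))
    ∎
  where
  open ≡.≡-Reasoning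
  open CommutativeSemigroup ℤ.*-commutativeSemigroup using (x∙yz≈y∙xz)
  S  = subsets (ground M)
  ε  = ℤ.-1ℤ ℤPoly.^ t
  P? = λ X → (rk M X ℕ.≟ k) ×-dec (∣ X ∣ ℕ.≟ m)
  flat place μ′ : Subset N → ℤ
  flat X  = ℤΣ.𝟙 (does (isFlat? M X))
  place X = ℤΣ.𝟙 (does (P? X))
  μ′ X = μ (Trun^ (rank M ∸ k ∸ t ∸ 1) (M / X))
  at : ∀ X → rk M X ≡ k × ∣ X ∣ ≡ m → ε ℤ.* μ′ X ≡ ℤΣ.coefficient M (k ℕ.+ t) X
  at X (≡.refl , _) = ℤΣ.signed-T-Trun-/ M t k+t<r

-- Transfer from the integers to `R`, and the expansion over flats

module TutteExpansion {c ℓ} (R : CommutativeRing c ℓ) where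
  open SubsetSums R
  open CommutativeRing R
  open Polynomials R
  open RingProperties ring
  open Mult semiring renaming (_×_ to _·_)
  open import Relation.Binary.Reasoning.Setoid setoid
  private
    module +-CS = CommutativeSemigroup +-commutativeSemigroup
    module *-CS = CommutativeSemigroup *-commutativeSemigroup

  -- Addition of integers of opposite signs computes to `⊖`; common successors cancel.
  ι-⊖ : ∀ m n → ι (m ℤ.⊖ n) ≈ m · 1# - n · 1#
  ι-⊖ zero    zero    = sym (-‿inverseʳ 0#)
  ι-⊖ zero    (suc n) = sym (+-identityˡ _)
  ι-⊖ (suc m) zero    = sym (trans (+-congˡ -0#≈0#) (+-identityʳ _))
  ι-⊖ (suc m) (suc n) = begin
    ι (suc m ℤ.⊖ suc n)                   ≡⟨ ≡.cong ι (ℤ.[1+m]⊖[1+n]≡m⊖n m n) ⟩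
    ι (m ℤ.⊖ n)                           ≈⟨ ι-⊖ m n ⟩
    m · 1# - n · 1#                       ≈⟨ +-identityˡ _ ⟨
    0# + (m · 1# - n · 1#)                ≈⟨ +-congʳ (-‿inverseʳ 1#) ⟨
    (1# - 1#) + (m · 1# - n · 1#)         ≈⟨ +-CS.interchange _ _ _ _ ⟩
    (1# + m · 1#) + (- 1# + - (n · 1#))   ≈⟨ +-congˡ (-‿+-comm _ _) ⟩
    (1# + m · 1#) - (1# + n · 1#)         ∎

  ι-+ : ∀ i j → ι (i ℤ.+ j) ≈ ι i + ι j
  ι-+ (+ m)    (+ n)    = ×-homo-+ 1# m n
  ι-+ (+ m)    -[1+ n ] = ι-⊖ m (suc n)
  ι-+ -[1+ m ] (+ n)    = trans (ι-⊖ n (suc m)) (+-comm _ _)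
  ι-+ -[1+ m ] -[1+ n ] = begin
    - (suc (suc (m ℕ.+ n)) · 1#)       ≡⟨ ≡.cong (λ k → - (suc k · 1#)) (ℕ.+-suc m n) ⟨
    - ((suc m ℕ.+ suc n) · 1#)         ≈⟨ -‿cong (×-homo-+ 1# (suc m) (suc n)) ⟩
    - (suc m · 1# + suc n · 1#)        ≈⟨ -‿+-comm _ _ ⟨
    - (suc m · 1#) + - (suc n · 1#)    ∎

  ι-∑ : (xs : List I) (f : I → ℤ) → ι (ℤPoly.∑ xs f) ≈ ∑ xs (ι ∘ f)
  ι-∑ []       f = refl
  ι-∑ (x ∷ xs) f = trans (ι-+ (f x) (ℤPoly.∑ xs f)) (+-congˡ (ι-∑ xs f))

  ι-neg : ∀ i → ι (ℤ.- i) ≈ - ι i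
  ι-neg (+ zero)  = sym -0#≈0#
  ι-neg (+ suc n) = refl
  ι-neg -[1+ n ]  = sym (-‿involutive (ι (+ suc n)))

  ι-sign : (B : Subset N) → ι (ℤΣ.sign B) ≈ sign B
  ι-sign B = go ∣ B ∣
    where
    go : ∀ n → ι (ℤ.-1ℤ ℤPoly.^ n) ≈ (- 1#) ^ n
    go zero    = +-identityʳ 1#
    go (suc n) = begin
      ι (ℤ.-1ℤ ℤ.* (ℤ.-1ℤ ℤPoly.^ n)) ≡⟨ ≡.cong ι (ℤ.-1*i≡-i (ℤ.-1ℤ ℤPoly.^ n)) ⟩
      ι (ℤ.- (ℤ.-1ℤ ℤPoly.^ n))       ≈⟨ ι-neg (ℤ.-1ℤ ℤPoly.^ n) ⟩
      - ι (ℤ.-1ℤ ℤPoly.^ n)           ≈⟨ -‿cong (go n) ⟩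
      - ((- 1#) ^ n)                  ≈⟨ -1*x≈-x _ ⟨
      - 1# * (- 1#) ^ n               ∎

  ι-𝟙-* : ∀ b i → ι (ℤΣ.𝟙 b ℤ.* i) ≈ 𝟙 b * ι i
  ι-𝟙-* true  i = trans (reflexive (≡.cong ι (ℤ.*-identityˡ i))) (sym (*-identityˡ _))
  ι-𝟙-* false i = sym (zeroˡ _)

  -- Flat numbers are integers, while the inversion takes place in `R`. The coefficient is a sum of
  -- indicators times signs, and `ι` respects each of these.
  ι-coefficient : (M : Matroid N) → ∀ i X → ι (ℤΣ.coefficient M i X) ≈ coefficient M i X
  ι-coefficient M i X = trans (ι-∑ S λ B → ℤΣ.𝟙 (rk M (B ∪ X) <ᵇ suc i) ℤ.* ℤΣ.sign B)
    (∑-cong S λ B → trans (ι-𝟙-* (rk M (B ∪ X) <ᵇ suc i) (ℤΣ.sign B)) (*-congˡ (ι-sign B)))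
    where S = subsets (ground M ─ X)

  -- The joint indicator of rank and size is split in two, so that `k` and `m` can be summed
  -- separately.
  ι-flatNumber : (M : Matroid N) → ∀ t k m → k ℕ.+ t < rank M →
    ι (flatNumber M t k m) ≈
    ∑ (subsets (ground M)) λ X → 𝟙 (does (isFlat? M X)) *
      (𝟙 (does (rk M X ℕ.≟ k)) * (𝟙 (does (∣ X ∣ ℕ.≟ m)) * coefficient M (k ℕ.+ t) X))
  ι-flatNumber M t k m k+t<r = begin
    ι (flatNumber M t k m)
      ≡⟨ ≡.cong ι (flatNumber-coefficient M t k m k+t<r) ⟩
    ι (ℤPoly.∑ S z)
      ≈⟨ ι-∑ S z ⟩
    ∑ S (ι ∘ z)
      ≈⟨ ∑-cong S (λ X → trans (ι-𝟙-* (does (isFlat? M X)) (z₁ X)) (*-congˡ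
           (trans (ι-𝟙-* (does (rk M X ℕ.≟ k) ∧ does (∣ X ∣ ℕ.≟ m)) (ℤΣ.coefficient M (k ℕ.+ t) X))
             (trans (*-congˡ (ι-coefficient M (k ℕ.+ t) X))
               (𝟙-∧ (does (rk M X ℕ.≟ k)) (does (∣ X ∣ ℕ.≟ m)) _))))) ⟩
    ∑ S (λ X → 𝟙 (does (isFlat? M X)) * (𝟙 (does (rk M X ℕ.≟ k)) *
      (𝟙 (does (∣ X ∣ ℕ.≟ m)) * coefficient M (k ℕ.+ t) X)))
      ∎
    where
    S = subsets (ground M)
    z z₁ : Subset _ → ℤ
    z₁ X = ℤΣ.𝟙 (does ((rk M X ℕ.≟ k) ×-dec (∣ X ∣ ℕ.≟ m))) ℤ.*
      ℤΣ.coefficient M (k ℕ.+ t) X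
    z X = ℤΣ.𝟙 (does (isFlat? M X)) ℤ.* z₁ X

  -- Each term depends only on the size of its set. The rank of `uniform r n` is a minimum, and
  -- `r ≤ n` makes it `r`.
  T-uniform : ∀ {r n} → r ≤ n → ∀ x y → T (uniform r n) x y ≈
    binomialSum n (λ s → (x - 1#) ^ (r ∸ (r ⊓ s)) * (y - 1#) ^ (s ∸ (r ⊓ s)))
  T-uniform {r} {n} r≤n x y = begin
    T (uniform r n) x y
      ≈⟨ ∑-subsets-card (⊤ {n}) (f (r ⊓ ∣ ⊤ {n} ∣)) ⟩
    binomialSum ∣ ⊤ {n} ∣ (f (r ⊓ ∣ ⊤ {n} ∣))
      ≡⟨ ≡.cong (λ k → binomialSum k (f (r ⊓ k))) (∣⊤∣≡n n) ⟩
    binomialSum n (f (r ⊓ n))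
      ≡⟨ ≡.cong (λ k → binomialSum n (f k)) (ℕ.m≤n⇒m⊓n≡m r≤n) ⟩
    binomialSum n (f r)
      ∎
    where
    f : ℕ → ℕ → Carrier
    f q s = (x - 1#) ^ (q ∸ (r ⊓ s)) * (y - 1#) ^ (s ∸ (r ⊓ s))

  [x-1][y-1] : ∀ x y → (x - 1#) * (y - 1#) ≈ 1# + ((x * y - x) - y)
  [x-1][y-1] x y = begin
    (x - 1#) * (y - 1#)                  ≈⟨ distribʳ (y - 1#) x (- 1#) ⟩
    x * (y - 1#) + - 1# * (y - 1#)       ≈⟨ +-cong (distribˡ x y (- 1#)) (-1*x≈-x _) ⟩
    x * y + x * - 1# + - (y - 1#)        ≈⟨ +-cong (+-congˡ (trans (sym (-‿distribʳ-* x 1#)) (-‿cong (*-identityʳ x)))) (⁻¹-anti-homo‿- y 1#) ⟩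
    (x * y - x) + (1# - y)               ≈⟨ +-CS.x∙yz≈y∙xz _ _ _ ⟩
    1# + ((x * y - x) - y)               ∎

  -- Summation over levels and flats

  module _ (M : Matroid N) (loopless : Loopless M) (x y : Carrier) where
    private
      r = rank M
      n = ∣ ground M ∣
      S = subsets (ground M)
      a = x - 1#
      b = y - 1#
      u = (x * y - x) - y

    -- What inversion at level `i` assigns to `X` in the factor of `u`, with the sum over the
    -- subsets of `X` already grouped by size.
    contribution : ℕ → Subset N → Carrier
    contribution i X = a ^ (r ∸ suc i) * (coefficient M i X * binomialSum ∣ X ∣ (excess b i))

    contribution≈0 : ∀ i X → coefficient M i X ≈ 0# → contribution i X ≈ 0#
    contribution≈0 i X eq = trans (*-congˡ (trans (*-congʳ eq) (zeroˡ _))) (zeroʳ _)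

    -- The parts of the expanded terms that are free of `u` depend only on size and add up to the
    -- uniform polynomial. The rest is inverted level by level and then regrouped by `X`.
    T-expansion : T M x y ≈ T (uniform r n) x y + u * ∑ S (λ X → ∑ (upTo r) (λ i → contribution i X))
    T-expansion = begin
      T M x y
        ≈⟨ ∑-cong S (λ A → rank-size-expansion a b u ([x-1][y-1] x y) (rk≤rank M A) (rk-card M A)) ⟩
      ∑ S (λ A → g ∣ A ∣ + u * ∑ (upTo r) (h A))
        ≈⟨ ∑-+ S _ _ ⟩
      ∑ S (g ∘ ∣_∣) + ∑ S (λ A → u * ∑ (upTo r) (h A))
        ≈⟨ +-cong
             (trans (∑-subsets-card (ground M) g) (sym (T-uniform (rk-card M (ground M)) x y)))
             (∑-*ˡ u S _) ⟩
      T (uniform r n) x y + u * ∑ S (λ A → ∑ (upTo r) (h A))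
        ≈⟨ +-congˡ (*-congˡ (∑-comm S (upTo r) h)) ⟩
      T (uniform r n) x y + u * ∑ (upTo r) (λ i → ∑ S (λ A → h A i))
        ≈⟨ +-congˡ (*-congˡ (∑-cong (upTo r) level)) ⟩
      T (uniform r n) x y + u * ∑ (upTo r) (λ i → ∑ S (contribution i))
        ≈⟨ +-congˡ (*-congˡ (∑-comm (upTo r) S contribution)) ⟩
      T (uniform r n) x y + u * ∑ S (λ X → ∑ (upTo r) (λ i → contribution i X))
        ∎
      where
      g : ℕ → Carrier
      g s = a ^ (r ∸ (r ⊓ s)) * b ^ (s ∸ (r ⊓ s))
      h : Subset N → ℕ → Carrier
      h A i = a ^ (r ∸ suc i) * (rk≤ M i A * excess b i ∣ A ∣)
      level : ∀ i → ∑ S (λ A → h A i) ≈ ∑ S (contribution i)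
      level i = begin
        ∑ S (λ A → h A i)
          ≈⟨ ∑-*ˡ _ S _ ⟩
        a ^ (r ∸ suc i) * ∑ S (λ A → rk≤ M i A * excess b i ∣ A ∣)
          ≈⟨ *-congˡ (möbius-inversion (ground M) (rk≤ M i) (excess b i ∘ ∣_∣)) ⟩
        a ^ (r ∸ suc i) * ∑ S (λ X → coefficient M i X * ∑ (subsets X) (excess b i ∘ ∣_∣))
          ≈⟨ *-congˡ (∑-cong S λ X → *-congˡ (∑-subsets-card X (excess b i))) ⟩
        a ^ (r ∸ suc i) * ∑ S (λ X → coefficient M i X * binomialSum ∣ X ∣ (excess b i))
          ≈⟨ ∑-*ˡ _ S _ ⟨
        ∑ S (contribution i)
          ∎

    inner : ℕ → Subset N → Carrier
    inner k X = ∑[ t ← [ 0 ⋯ r ∸ k ∸ 1 ] ] contribution (k ℕ.+ t) X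

    -- Levels below the rank of `X` vanish; the others are written as rank plus `t`.
    ∑-contribution : ∀ X → rk M X < r → ∑ (upTo r) (λ i → contribution i X) ≈ inner (rk M X) X
    ∑-contribution X k<r = begin
      ∑ (upTo r) (λ i → contribution i X)
        ≡⟨ ≡.cong (λ q → ∑ (upTo q) (λ i → contribution i X)) (ℕ.m+[n∸m]≡n (ℕ.<⇒≤ k<r)) ⟨
      ∑ (upTo (k ℕ.+ (r ∸ k))) (λ i → contribution i X)
        ≈⟨ ∑-upTo-+ k (r ∸ k) _ ⟩
      ∑ (upTo k) (λ i → contribution i X) + rest (r ∸ k)
        ≈⟨ +-congʳ (∑-upTo-zero k λ i<k → contribution≈0 _ X (coefficient-low M i<k)) ⟩
      0# + rest (r ∸ k)
        ≈⟨ +-identityˡ _ ⟩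
      rest (r ∸ k)
        -- The interval from 0 to `r ∸ k ∸ 1` has `suc (r ∸ k ∸ 1)` entries, which is `r ∸ k`
        -- because `k < r`.
        ≡⟨ ≡.cong rest (ℕ.m+[n∸m]≡n (ℕ.m<n⇒0<n∸m k<r)) ⟨
      inner k X
        ∎
      where
      k = rk M X
      rest : ℕ → Carrier
      rest q = ∑ (upTo q) (λ t → contribution (k ℕ.+ t) X)

    -- The share of one set in the sums over `k`, `m` and `t`, flatness aside: the indicators select
    -- the `k` and `m` that fit `X`, if they are in range.
    located : Subset N → Carrier
    located X = ∑[ k ← [ 1 ⋯ r ∸ 1 ] ] 𝟙 (does (rk M X ℕ.≟ k)) *
      (∑[ m ← [ k ⋯ n ] ] 𝟙 (does (∣ X ∣ ℕ.≟ m)) * inner k X)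

    located-nowhere : ∀ X → (∀ {k} → 1 ≤ k → k ≤ r ∸ 1 → ¬ rk M X ≡ k) → located X ≈ 0#
    located-nowhere X none = trans
      (∑-⋯-cong 1 (r ∸ 1) λ {k} 1≤k k≤r-1 → 𝟙-no (rk M X ℕ.≟ k) _ (none 1≤k k≤r-1))
      (∑-zero [ 1 ⋯ r ∸ 1 ])

    -- In rank 0 the set is empty, as there are no loops, and has no excess at any level. In rank
    -- `r` all levels lie below the rank. The ranks in between are those in the range of `k`.
    located-contribution : ∀ X → X ⊆ ground M →
      ∑ (upTo r) (λ i → contribution i X) ≈ located X
    located-contribution X X⊆E with rk M X ℕ.≟ 0 | ℕ.≤-<-connex r (rk M X)
    ... | yes rk≡0 | _ = trans
      (∑-upTo-zero r λ {i} _ → trans (*-congˡ (trans (*-congˡ (empty i)) (zeroʳ _))) (zeroʳ _))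
      (sym (located-nowhere X λ 1≤k _ rk≡k → ℕ.<⇒≢ 1≤k (≡.trans (≡.sym rk≡0) rk≡k)))
      where
      empty : ∀ i → binomialSum ∣ X ∣ (excess b i) ≈ 0#
      empty i = binomialSum-excess≈0 b
        (ℕ.≤-trans (ℕ.≤-reflexive (loopless-rk-0 M loopless X⊆E rk≡0)) z≤n)
    ... | no _ | inj₁ r≤rk = trans
      (∑-upTo-zero r λ i<r → contribution≈0 _ X (coefficient-low M (ℕ.≤-trans i<r r≤rk)))
      (sym (located-nowhere X λ 1≤k k≤r-1 rk≡k → ℕ.<⇒≱ (≤∸1⇒< 1≤k k≤r-1) (ℕ.≤-trans r≤rk (ℕ.≤-reflexive rk≡k))))
    ... | no rk≢0 | inj₂ rk<r = begin
      ∑ (upTo r) (λ i → contribution i X)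
        ≈⟨ ∑-contribution X rk<r ⟩
      inner (rk M X) X
        -- The sum over `m` reaches the size of `X`, which is at least its rank and at most `n`.
        ≈⟨ ∑-⋯-δ (rk M X) n ∣ X ∣ (λ _ → inner (rk M X) X) (rk-card M X) (p⊆q⇒∣p∣≤∣q∣ X⊆E) ⟨
      (∑[ m ← [ rk M X ⋯ n ] ] 𝟙 (does (∣ X ∣ ℕ.≟ m)) * inner (rk M X) X)
        ≈⟨ ∑-⋯-δ 1 (r ∸ 1) (rk M X) _ (ℕ.n≢0⇒n>0 rk≢0) (ℕ.∸-monoˡ-≤ 1 rk<r) ⟨
      located X
        ∎

    flat-located : ∀ X → X ⊆ ground M →
      ∑ (upTo r) (λ i → contribution i X) ≈ 𝟙 (does (isFlat? M X)) * located X
    flat-located X X⊆E = 𝟙-guard (isFlat? M X)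
      (λ _ → located-contribution X X⊆E)
      (λ ¬flat → ∑-upTo-zero r λ {i} _ →
        contribution≈0 i X (coefficient-non-flat M i X⊆E ¬flat))

    flatTerm : ℕ → ℕ → ℕ → Carrier
    flatTerm k m t = ι (flatNumber M t k m) * a ^ (r ∸ k ∸ t ∸ 1) *
      τ (+ (k ℕ.+ 1 ℕ.+ t)) (+ m ℤ.- + k ℤ.- + t ℤ.- + 1) y

    -- By `τ-⊖` the factor `τ` is a binomial sum over sets of size `m`, and the size indicator
    -- allows `m` to be replaced by the size of `X`.
    flatTerm-contribution : ∀ k m t → k ℕ.+ t < r → flatTerm k m t ≈
      ∑ S (λ X → 𝟙 (does (isFlat? M X)) * (𝟙 (does (rk M X ℕ.≟ k)) *
        (𝟙 (does (∣ X ∣ ℕ.≟ m)) * contribution (k ℕ.+ t) X)))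
    flatTerm-contribution k m t k+t<r = begin
      flatTerm k m t
        ≈⟨ *-cong (*-cong (ι-flatNumber M t k m k+t<r) (reflexive (≡.cong (a ^_) (∸-∸-1 r k t))))
             (trans (reflexive (≡.cong₂ (λ d j → τ (+ d) j y)
               (≡.cong (ℕ._+ t) (ℕ.+-comm k 1)) (τ-argument m k t))) (τ-⊖ y i m)) ⟩
      ∑ S c′ * p * q m
        ≈⟨ *-assoc _ p (q m) ⟩
      ∑ S c′ * (p * q m)
        ≈⟨ ∑-*ʳ (p * q m) S c′ ⟨
      ∑ S (λ X → c′ X * (p * q m))
        ≈⟨ ∑-cong S (λ X → trans (*-assoc _ _ _) (*-congˡ (trans (*-assoc _ _ _)
             (*-congˡ (trans (*-assoc _ _ _) (𝟙-cong (∣ X ∣ ℕ.≟ m) λ { ≡.refl →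
               *-CS.x∙yz≈y∙xz (coefficient M i X) p (q ∣ X ∣) })))))) ⟩
      _
        ∎
      where
      i = k ℕ.+ t
      p = a ^ (r ∸ suc i)
      q : ℕ → Carrier
      q s = binomialSum s (excess b i)
      c′ : Subset N → Carrier
      c′ X = 𝟙 (does (isFlat? M X)) * (𝟙 (does (rk M X ℕ.≟ k)) *
        (𝟙 (does (∣ X ∣ ℕ.≟ m)) * coefficient M i X))

    -- The sum over `X` moves outwards past `t`, `m` and `k`, and at each stage the indicators free
    -- of the summation index are factored out.
    ∑-flatTerm :
      (∑[ k ← [ 1 ⋯ r ∸ 1 ] ] ∑[ m ← [ k ⋯ n ] ] ∑[ t ← [ 0 ⋯ r ∸ k ∸ 1 ] ] flatTerm k m t) ≈
      ∑ S (λ X → 𝟙 (does (isFlat? M X)) * located X)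
    ∑-flatTerm = begin
      (∑[ k ← Ks ] ∑[ m ← [ k ⋯ n ] ] ∑[ t ← [ 0 ⋯ r ∸ k ∸ 1 ] ] flatTerm k m t)
        ≈⟨ ∑-⋯-cong 1 (r ∸ 1) (λ {k} 1≤k k≤r-1 → ∑-cong [ k ⋯ n ] λ m →
             ∑-⋯-cong 0 (r ∸ k ∸ 1) λ {t} _ t≤ → flatTerm-contribution k m t (bound 1≤k k≤r-1 t≤)) ⟩
      (∑[ k ← Ks ] ∑[ m ← [ k ⋯ n ] ] ∑[ t ← [ 0 ⋯ r ∸ k ∸ 1 ] ]
        ∑ S (λ X → F X * (K X k * (Z X m * contribution (k ℕ.+ t) X))))
        ≈⟨ ∑-cong Ks (λ k → ∑-cong [ k ⋯ n ] λ m → trans (∑-comm [ 0 ⋯ r ∸ k ∸ 1 ] S _)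
             (∑-cong S λ X → trans (∑-*ˡ (F X) [ 0 ⋯ r ∸ k ∸ 1 ] _)
               (*-congˡ (trans (∑-*ˡ (K X k) [ 0 ⋯ r ∸ k ∸ 1 ] _)
                 (*-congˡ (∑-*ˡ (Z X m) [ 0 ⋯ r ∸ k ∸ 1 ] _)))))) ⟩
      (∑[ k ← Ks ] ∑[ m ← [ k ⋯ n ] ] ∑ S (λ X → F X * (K X k * (Z X m * inner k X))))
        ≈⟨ ∑-cong Ks (λ k → trans (∑-comm [ k ⋯ n ] S _)
             (∑-cong S λ X → trans (∑-*ˡ (F X) [ k ⋯ n ] _) (*-congˡ (∑-*ˡ (K X k) [ k ⋯ n ] _)))) ⟩
      (∑[ k ← Ks ] ∑ S (λ X → F X * (K X k * (∑[ m ← [ k ⋯ n ] ] Z X m * inner k X))))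
        ≈⟨ trans (∑-comm Ks S _) (∑-cong S λ X → ∑-*ˡ (F X) Ks _) ⟩
      ∑ S (λ X → F X * located X)
        ∎
      where
      Ks = [ 1 ⋯ r ∸ 1 ]
      F : Subset N → Carrier
      F X = 𝟙 (does (isFlat? M X))
      K Z : Subset N → ℕ → Carrier
      K X k = 𝟙 (does (rk M X ℕ.≟ k))
      Z X m = 𝟙 (does (∣ X ∣ ℕ.≟ m))
      bound : ∀ {k t} → 1 ≤ k → k ≤ r ∸ 1 → t ≤ r ∸ k ∸ 1 → k ℕ.+ t < r
      bound {k} {t} 1≤k k≤r-1 t≤ = ℕ.≤-trans (ℕ.≤-reflexive (≡.cong suc (ℕ.+-comm k t)))
        (ℕ.m≤o∸n⇒m+n≤o (suc t) (ℕ.<⇒≤ k<r)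
          (ℕ.≤-trans (s≤s t≤) (ℕ.≤-reflexive (ℕ.m+[n∸m]≡n (ℕ.m<n⇒0<n∸m k<r)))))
        where k<r = ≤∸1⇒< 1≤k k≤r-1

    T-flat-expansion : T M x y ≈ T (uniform r n) x y + u *
      (∑[ k ← [ 1 ⋯ r ∸ 1 ] ] ∑[ m ← [ k ⋯ n ] ] ∑[ t ← [ 0 ⋯ r ∸ k ∸ 1 ] ] flatTerm k m t)
    T-flat-expansion = trans T-expansion (+-congˡ (*-congˡ (trans
      (∑-subsets-cong (ground M) flat-located) (sym ∑-flatTerm))))

mainTheorem3 : ∀ {c ℓ} (R : CommutativeRing c ℓ) {N : ℕ} (M : Matroid N) (r n : ℕ) →
    Matroid.rank M ≡ r →
    ∣ Matroid.ground M ∣ ≡ n →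
    1 ≤ r →
    Matroid.Loopless M →
    let open CommutativeRing R
        open Polynomials R
    in
    ∀ (x y : Carrier) →
    T M x y ≈
      T (uniform r n) x y +
      ((x * y - x) - y) *
        (∑[ k ← [ 1 ⋯ r ∸ 1 ] ] ∑[ m ← [ k ⋯ n ] ] ∑[ t ← [ 0 ⋯ r ∸ k ∸ 1 ] ]
          (ι (flatNumber M t k m) *
           (x - 1#) ^ (r ∸ k ∸ t ∸ 1) *
           τ (+ (k ℕ.+ 1 ℕ.+ t)) (+ m ℤ.- + k ℤ.- + t ℤ.- + 1) y))
mainTheorem3 R M r n ≡.refl ≡.refl _ loopless x y =
  TutteExpansion.T-flat-expansion R M loopless x y
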